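{- Let $D$ be a locally in-semicomplete digraph, a locally out-semicomplete digraph, or a locally semicomplete digraph. Then $D$ is a KP-digraph if and only if $D$ has no induced subdigraph $H$ such that $H$ is a directed odd cycle, $H\cong \overrightarrow{C}_7(1,2)$, or $H\cong \overrightarrow{C}_n(1,\pm2,\pm3,\dots,\pm\lfloor \frac{n}{2}\rfloor)$ for some $n\ge4$.
   Context: Digraphs are finite, without loops or parallel arcs; both arcs $uv$ and $vu$ may be present. A digraph is semicomplete if every two distinct vertices are joined by at least one arc. $D$ is locally in-semicomplete (resp. locally out-semicomplete) if for every vertex $v$ the in-neighbourhood $N^-(v)$ (resp. out-neighbourhood $N^+(v)$) induces a semicomplete subdigraph; locally semicomplete means both. A kernel is a set $S$ of vertices that is independent (no arc between two vertices of $S$) and absorbent (every vertex outside $S$ has an arc into $S$). $D$ is a KP-digraph if $D$ and every induced subdigraph of $D$ have a kernel. For nonempty $J\subseteq\mathbb{Z}_m\setminus\{0\}$, $\overrightarrow{C}_m(J)$ has vertex set $\mathbb{Z}_m$ and arcs $(i,j)$ with $j-i\in J$; $\overrightarrow{C}_7(1,2)$ has $J=\{1,2\}$ and $\overrightarrow{C}_n(1,\pm2,\dots,\pm\lfloor n/2\rfloor)$ has $J=\{1\}\cup\{\pm k:2\le k\le\lfloor n/2\rfloor\}$. -}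

module Defs where

open import Data.Nat using (ℕ; zero; suc; _+_; _∸_; _≤_; _<_; _/_; _%_)
open import Data.Fin using (Fin; toℕ)
open import Data.Bool using (Bool; true; false)
open import Data.Product using (Σ; _×_; _,_; ∃)
open import Data.Sum using (_⊎_)
open import Relation.Binary.PropositionalEquality using (_≡_; _≢_)
open import Relation.Nullary using (¬_)
open import Function.Definitions using (Injective)

record Digraph : Set where
  field
    n     : ℕ
    arc   : Fin n → Fin n → Bool
    loopless : ∀ v → arc v v ≡ false

open Digraph public

Arc : (D : Digraph) → Fin (n D) → Fin (n D) → Set
Arc D u v = arc D u v ≡ true

SemicompleteOn : (D : Digraph) → (Fin (n D) → Set) → Set
SemicompleteOn D P = ∀ u v → P u → P v → u ≢ v → Arc D u v ⊎ Arc D v u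

LocallyInSemicomplete : Digraph → Set
LocallyInSemicomplete D = ∀ w → SemicompleteOn D (λ u → Arc D u w)

LocallyOutSemicomplete : Digraph → Set
LocallyOutSemicomplete D = ∀ w → SemicompleteOn D (λ u → Arc D w u)

LocallySemicomplete : Digraph → Set
LocallySemicomplete D = LocallyInSemicomplete D × LocallyOutSemicomplete D

IsKernel : (D : Digraph) → (Fin (n D) → Bool) → Set
IsKernel D S =
  (∀ u v → S u ≡ true → S v ≡ true → ¬ Arc D u v)
  × (∀ u → S u ≡ false → Σ (Fin (n D)) λ v → S v ≡ true × Arc D u v)

HasKernel : Digraph → Set
HasKernel D = Σ (Fin (n D) → Bool) λ S → IsKernel D S

record InducedEmbedding (H D : Digraph) : Set where
  field
    f        : Fin (n H) → Fin (n D)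
    f-inj    : Injective _≡_ _≡_ f
    f-arc    : ∀ u v → arc D (f u) (f v) ≡ arc H u v

-- the subdigraph of D induced by a vertex subset, presented on Fin m
-- via an injective map (every induced subdigraph arises this way up to
-- relabelling, including the empty one)
induced : (D : Digraph) (m : ℕ) (g : Fin m → Fin (n D)) → Digraph
induced D m g = record
  { n = m
  ; arc = λ u v → arc D (g u) (g v)
  ; loopless = λ v → loopless D (g v) }

KP : Digraph → Set
KP D = HasKernel D ×
  (∀ (m : ℕ) (g : Fin m → Fin (n D)) → Injective _≡_ _≡_ g → HasKernel (induced D m g))

-- Circulant digraphs C_m(J), J given as a decidable predicate on the
-- residue j - i mod m (only values in 1..m-1 ever arise for i ≠ j).
open import Data.Nat using (_≡ᵇ_; _≤ᵇ_; NonZero)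
open import Data.Bool using (_∧_; _∨_; not; if_then_else_)

diffMod : (m : ℕ) → Fin m → Fin m → ℕ
diffMod zero    i j = 0
diffMod (suc k) i j = (toℕ j + suc k ∸ toℕ i) % suc k

open import Data.Fin.Properties using ()
open import Data.Nat.DivMod using (n%n≡0)
import Data.Nat.Properties

circArc : (m : ℕ) → (ℕ → Bool) → Fin m → Fin m → Bool
circArc m J i j = not (diffMod m i j ≡ᵇ 0) ∧ J (diffMod m i j)


open import Relation.Binary.PropositionalEquality using (refl; cong)

diffMod-refl : ∀ m (i : Fin m) → diffMod m i i ≡ 0
diffMod-refl (suc k) i rewrite Data.Nat.Properties.+-comm (toℕ i) (suc k)
  | Data.Nat.Properties.m+n∸n≡m (suc k) (toℕ i) = n%n≡0 (suc k)

circArc-loopless : ∀ m J (i : Fin m) → circArc m J i i ≡ false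
circArc-loopless m J i rewrite diffMod-refl m i = refl

Circulant : (m : ℕ) → (ℕ → Bool) → Digraph
Circulant m J = record { n = m ; arc = circArc m J ; loopless = circArc-loopless m J }

dirCycleJ : ℕ → Bool
dirCycleJ d = d ≡ᵇ 1

DirectedCycle : ℕ → Digraph
DirectedCycle m = Circulant m dirCycleJ

C7-12-J : ℕ → Bool
C7-12-J d = (d ≡ᵇ 1) ∨ (d ≡ᵇ 2)

C7-12 : Digraph
C7-12 = Circulant 7 C7-12-J

-- C_m(1, ±2, ..., ±⌊m/2⌋): d = 1, or 2 ≤ d ≤ ⌊m/2⌋, or 2 ≤ m - d ≤ ⌊m/2⌋
CnJ : ℕ → ℕ → Bool
CnJ m d = (d ≡ᵇ 1) ∨ ((2 ≤ᵇ d) ∧ (d ≤ᵇ m / 2)) ∨ ((2 ≤ᵇ (m ∸ d)) ∧ ((m ∸ d) ≤ᵇ m / 2))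

Cn : ℕ → Digraph
Cn m = Circulant m (CnJ m)

Forbidden : Digraph → Set
Forbidden H =
    (Σ ℕ λ k → InducedEmbedding (DirectedCycle (suc (suc (suc (k + k))))) H)
  ⊎ InducedEmbedding C7-12 H
  ⊎ (Σ ℕ λ m → 4 ≤ m × InducedEmbedding (Cn m) H)

{-# OPTIONS --safe #-}
module Submission where

-- Suppose D is locally in-semicomplete, has no forbidden subdigraph and no kernel, although all D − v have one.
-- In a semicomplete set without a sink, a shortest closed walk of asymmetric arcs is a C₃ or a Cₙ(1,±2,…), so semicomplete
-- sets have sinks. A kernel of D − v₀ gives an independent set S whose union with {v₀} absorbs D and contains a single
-- arc s₀ → v₀. Moving the token s₀ to v₀ leaves unabsorbed only in-neighbours of s₀, which have a sink v₁; again
-- exactly one token s₁ has an arc to v₁, and so on forever. Let k tokens move before one moves for the second time. Then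
-- either an induced odd cycle of length 2k + 1 closes up, or there is a chord s_a → v_{a+k}, which forces the same k tokens
-- (or just one of them) to keep moving in turn. For k = 1 this is an asymmetric walk in a semicomplete set. For k ≥ 2 the
-- sequence P of the moved tokens has arcs P_x → P_{x+k}, P_{x+k+1} → P_x, P_x → P_{x+2k}, P_{x+2k+1} → P_x, and no
-- others between indices less than 3k apart, so it contains C₃ or C₇(1,2) (k = 2), or an induced cycle of length 2k − 1 (k ≥ 3).
--
-- If D is locally out-semicomplete instead, let S_v be a kernel of D − v. Each closed out-neighbourhood N⁺[u], u ≠ v,
-- contains exactly one vertex of S_v, and N⁺[v] contains none: the matrices M of closed out-neighbourhoods and S satisfy
-- M S = J − I. Hence they commute and D is regular, which makes every closed in-neighbourhood equal to a closed
-- out-neighbourhood; so D is locally in-semicomplete after all.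

open import Defs
open import Data.Bool using (Bool; true; false; not; _∧_; _∨_; T)
import Data.Bool.Properties as Boolₚ
open import Data.Empty using (⊥; ⊥-elim)
open import Data.Fin as Fin using (Fin; toℕ; fromℕ<; punchIn; punchOut)
open import Data.Fin.Properties as Finₚ using (toℕ<n; toℕ-injective; toℕ-fromℕ<)
open import Data.Fin.Subset.Properties using (anySubset?)
import Data.Nat as ℕ
open import Data.Nat using (ℕ; zero; suc)
import Data.Nat.Properties as ℕₚ
open import Data.Product using (Σ; ∃; ∃₂; _×_; _,_; proj₁; proj₂)
open import Data.Sum using (_⊎_; inj₁; inj₂; [_,_]′)
open import Data.Unit using (tt)
open import Data.Vec using (lookup; tabulate)
open import Data.Vec.Functional using (insertAt)
open import Data.Vec.Functional.Properties using (insertAt-lookup; insertAt-punchIn)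
open import Data.Vec.Properties using (lookup∘tabulate)
open import Function using (_∘_; id)
open import Function.Bundles using (_⇔_; mk⇔)
open import Function.Definitions using (Injective)
open import Relation.Binary.Definitions using (tri<; tri≈; tri>)
open import Relation.Binary.PropositionalEquality
open import Relation.Nullary using (¬_; Dec; yes; no; does)
open import Relation.Nullary.Decidable
  using (map′; toWitness; toWitnessFalse; _→-dec_; _×-dec_; _⊎-dec_; ¬?; decidable-stable)

-- Square matrices over ℤ

module LinearAlgebra where
  open import Data.Integer as Integer using (ℤ; +_; 0ℤ; 1ℤ; ∣_∣; _+_; _*_; _-_; -_; _≟_)
  import Data.Integer.Properties as ℤₚ
  open import Data.Integer.Tactic.RingSolver using (solve-∀)
  open import Algebra.Bundles using (Ring)
  open import Algebra.Properties.Group (Ring.+-group ℤₚ.+-*-ring) using (∙-cancelˡ; ∙-cancelʳ)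
  open import Algebra.Properties.Semiring.Sum (Ring.semiring ℤₚ.+-*-ring)
    using (sum; sum-cong-≗; sum-remove; sum-replicate-zero; ∑-distrib-+; ∑-comm; *-distribˡ-sum; *-distribʳ-sum)
  open import Data.Vec.Functional using (removeAt)
  open ≡-Reasoning

  sum-zero : ∀ {n} {f : Fin n → ℤ} → (∀ i → f i ≡ 0ℤ) → sum f ≡ 0ℤ
  sum-zero {n} f≡0 = trans (sum-cong-≗ f≡0) (sum-replicate-zero n)

  sum-single : ∀ {n} (f : Fin n → ℤ) p → (∀ i → i ≢ p → f i ≡ 0ℤ) → sum f ≡ f p
  sum-single {suc n} f p f≡0 = begin
    sum f                     ≡⟨ sum-remove {i = p} f ⟩
    f p + sum (removeAt f p)  ≡⟨ cong (_+_ (f p)) (sum-zero (λ i → f≡0 _ (Finₚ.punchInᵢ≢i p i))) ⟩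
    f p + 0ℤ                  ≡⟨ ℤₚ.+-identityʳ (f p) ⟩
    f p                       ∎

  sum-except : ∀ {n} (f g : Fin n → ℤ) p → g p ≡ 0ℤ → (∀ i → i ≢ p → g i ≡ f i) → sum g + f p ≡ sum f
  sum-except {suc n} f g p gp≡0 g≡f = begin
    sum g + f p                       ≡⟨ cong (_+ f p) (sum-remove {i = p} g) ⟩
    g p + sum (removeAt g p) + f p    ≡⟨ cong₂ (λ x y → x + y + f p) gp≡0 (sum-cong-≗ (λ i → g≡f _ (Finₚ.punchInᵢ≢i p i))) ⟩
    0ℤ + sum (removeAt f p) + f p     ≡⟨ cong (_+ f p) (ℤₚ.+-identityˡ (sum (removeAt f p))) ⟩
    sum (removeAt f p) + f p          ≡⟨ ℤₚ.+-comm (sum (removeAt f p)) (f p) ⟩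
    f p + sum (removeAt f p)          ≡⟨ sum-remove {i = p} f ⟨
    sum f                             ∎

  sum-constant : ∀ n z → sum {n} (λ _ → z) ≡ + n * z
  sum-constant zero z = sym (ℤₚ.*-zeroˡ z)
  sum-constant (suc n) z = trans (cong (_+_ (z)) (sum-constant n z)) (sym (ℤₚ.suc-* (+ n) z))

  *-nonzero : ∀ {x y} → x ≢ 0ℤ → y ≢ 0ℤ → x * y ≢ 0ℤ
  *-nonzero {x} x≢0 y≢0 eq = [ x≢0 , y≢0 ]′ (ℤₚ.i*j≡0⇒i≡0∨j≡0 x eq)

  -- Gaussian elimination without fractions: with a pivot `a` in the first row, each later row is
  -- multiplied by `a`, reduced by a multiple of the first row, and the pivot column is dropped.
  dependent : ∀ n (A : Fin n → Fin (suc n) → ℤ) →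
    ∃ λ (z : Fin (suc n) → ℤ) → (∃ λ j → z j ≢ 0ℤ) × (∀ i → sum (λ j → A i j * z j) ≡ 0ℤ)
  dependent zero A = (λ _ → 1ℤ) , (Fin.zero , λ ()) , λ ()
  dependent (suc n) A with Finₚ.any? (λ p → ¬? (A Fin.zero p ≟ 0ℤ))
  ... | no none = z , nonzero , solves
    where
    rec = dependent n (λ i j → A (Fin.suc i) (Fin.suc j))
    z : Fin (suc (suc n)) → ℤ
    z Fin.zero    = 0ℤ
    z (Fin.suc j) = proj₁ rec j
    nonzero : ∃ λ j → z j ≢ 0ℤ
    nonzero = Fin.suc (proj₁ (proj₁ (proj₂ rec))) , proj₂ (proj₁ (proj₂ rec))
    solves : ∀ i → sum (λ j → A i j * z j) ≡ 0ℤ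
    solves Fin.zero = sum-zero λ j → trans
      (cong (_* z j) (decidable-stable (A Fin.zero j ≟ 0ℤ) λ ≢0 → none (j , ≢0))) (ℤₚ.*-zeroˡ (z j))
    solves (Fin.suc i) = trans (cong₂ _+_ (ℤₚ.*-zeroʳ (A (Fin.suc i) Fin.zero)) (proj₂ (proj₂ rec) i)) refl
  ... | yes (p , pivot≢0) = z , nonzero , solves
    where
    a : ℤ
    a = A Fin.zero p
    row : Fin (suc n) → ℤ
    row j = A Fin.zero (punchIn p j)
    rec = dependent n (λ i j → a * A (Fin.suc i) (punchIn p j) - A (Fin.suc i) p * row j)
    z′ = proj₁ rec
    total = sum (λ j → row j * z′ j)
    -- Scaling the smaller solution by the pivot lets the pivot unknown be the integer `- total`;
    -- the multiples of `total` then cancel in every row.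
    z = insertAt (λ j → a * z′ j) p (- total)
    nonzero : ∃ λ j → z j ≢ 0ℤ
    nonzero = let (j , zj≢0) = proj₁ (proj₂ rec) in punchIn p j ,
      λ eq → *-nonzero pivot≢0 zj≢0 (trans (sym (insertAt-punchIn (λ j → a * z′ j) p (- total) j)) eq)

    expand : ∀ i → sum (λ j → A i j * z j) ≡ A i p * - total + sum (λ j → A i (punchIn p j) * (a * z′ j))
    expand i = trans (sum-remove {i = p} (λ j → A i j * z j)) (cong₂ _+_
      (cong (A i p *_) (insertAt-lookup (λ j → a * z′ j) p (- total)))
      (sum-cong-≗ λ j → cong (A i (punchIn p j) *_) (insertAt-punchIn (λ j → a * z′ j) p (- total) j)))

    rearrange₁ : ∀ r a z → r * (a * z) ≡ a * (r * z)
    rearrange₁ = solve-∀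
    rearrange₂ : ∀ a r z b w → r * (a * z) ≡ b * (w * z) + (a * r - b * w) * z
    rearrange₂ = solve-∀
    cancel : ∀ a t → a * - t + a * t ≡ 0ℤ
    cancel = solve-∀
    cancel′ : ∀ b t → b * - t + (b * t + 0ℤ) ≡ 0ℤ
    cancel′ = solve-∀

    solves : ∀ i → sum (λ j → A i j * z j) ≡ 0ℤ
    solves Fin.zero = begin
      sum (λ j → A Fin.zero j * z j)                 ≡⟨ expand Fin.zero ⟩
      a * - total + sum (λ j → row j * (a * z′ j))   ≡⟨ cong (_+_ (a * - total)) (sum-cong-≗ (λ j → rearrange₁ (row j) a (z′ j))) ⟩
      a * - total + sum (λ j → a * (row j * z′ j))   ≡⟨ cong (_+_ (a * - total)) (*-distribˡ-sum a (λ j → row j * z′ j)) ⟨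
      a * - total + a * total                        ≡⟨ cancel a total ⟩
      0ℤ                                             ∎
    solves (Fin.suc i) = begin
      sum (λ j → A (Fin.suc i) j * z j)
        ≡⟨ expand (Fin.suc i) ⟩
      b * - total + sum (λ j → A (Fin.suc i) (punchIn p j) * (a * z′ j))
        ≡⟨ cong (_+_ (b * - total)) (sum-cong-≗ (λ j → rearrange₂ a (A (Fin.suc i) (punchIn p j)) (z′ j) b (row j))) ⟩
      b * - total + sum (λ j → b * (row j * z′ j) + (a * A (Fin.suc i) (punchIn p j) - b * row j) * z′ j)
        ≡⟨ cong (_+_ (b * - total)) (∑-distrib-+ (λ j → b * (row j * z′ j)) (λ j → (a * A (Fin.suc i) (punchIn p j) - b * row j) * z′ j)) ⟩
      b * - total + (sum (λ j → b * (row j * z′ j)) + sum (λ j → (a * A (Fin.suc i) (punchIn p j) - b * row j) * z′ j))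
        ≡⟨ cong₂ (λ x y → b * - total + (x + y)) (sym (*-distribˡ-sum b (λ j → row j * z′ j))) (proj₂ (proj₂ rec) i) ⟩
      b * - total + (b * total + 0ℤ)
        ≡⟨ cancel′ b total ⟩
      0ℤ ∎
      where b = A (Fin.suc i) p

  sum-product-comm : ∀ {n m l} (A : Fin n → Fin m → ℤ) (B : Fin m → Fin l → ℤ) (z : Fin l → ℤ) i →
    sum (λ j → A i j * sum (λ k → B j k * z k)) ≡ sum (λ k → sum (λ j → A i j * B j k) * z k)
  sum-product-comm A B z i = begin
    sum (λ j → A i j * sum (λ k → B j k * z k))     ≡⟨ sum-cong-≗ (λ j → *-distribˡ-sum (A i j) (λ k → B j k * z k)) ⟩
    sum (λ j → sum (λ k → A i j * (B j k * z k)))   ≡⟨ ∑-comm (λ j k → A i j * (B j k * z k)) ⟩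
    sum (λ k → sum (λ j → A i j * (B j k * z k)))   ≡⟨ sum-cong-≗ (λ k → sum-cong-≗ (λ j → sym (ℤₚ.*-assoc (A i j) (B j k) (z k)))) ⟩
    sum (λ k → sum (λ j → A i j * B j k * z k))     ≡⟨ sum-cong-≗ (λ k → sym (*-distribʳ-sum (z k) (λ j → A i j * B j k))) ⟩
    sum (λ k → sum (λ j → A i j * B j k) * z k)     ∎

  Natural : ℤ → Set
  Natural z = ∃ λ k → z ≡ + k

  sum-natural : ∀ {n} {f : Fin n → ℤ} → (∀ i → Natural (f i)) → Natural (sum f)
  sum-natural {zero} _ = 0 , refl
  sum-natural {suc n} nat with nat Fin.zero | sum-natural (nat ∘ Fin.suc)
  ... | k , eq | l , eq′ = k ℕ.+ l , cong₂ _+_ eq eq′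

  natural-sum-zero : ∀ {n} {f : Fin n → ℤ} → (∀ i → Natural (f i)) → sum f ≡ 0ℤ → ∀ i → f i ≡ 0ℤ
  natural-sum-zero {suc n} {f} nat sum≡0 i with nat Fin.zero | sum-natural (nat ∘ Fin.suc)
  ... | k , eq | l , eq′ = go i
    where
    k+l≡0 : k ℕ.+ l ≡ 0
    k+l≡0 = ℤₚ.+-injective (trans (sym (cong₂ _+_ eq eq′)) sum≡0)
    go : ∀ i → f i ≡ 0ℤ
    go Fin.zero    = trans eq (cong +_ (ℕₚ.m+n≡0⇒m≡0 k k+l≡0))
    go (Fin.suc i) = natural-sum-zero (nat ∘ Fin.suc) (trans eq′ (cong +_ (ℕₚ.m+n≡0⇒n≡0 k k+l≡0))) i

  ⟦_⟧ : Bool → ℤ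
  ⟦ true  ⟧ = 1ℤ
  ⟦ false ⟧ = 0ℤ

  ⟦⟧-natural : ∀ b → Natural ⟦ b ⟧
  ⟦⟧-natural true  = 1 , refl
  ⟦⟧-natural false = 0 , refl

  ⟦⟧*⟦⟧-zero : ∀ {a b} → (a ≡ true → b ≡ true → ⊥) → ⟦ a ⟧ * ⟦ b ⟧ ≡ 0ℤ
  ⟦⟧*⟦⟧-zero {true} {true} ¬ab = ⊥-elim (¬ab refl refl)
  ⟦⟧*⟦⟧-zero {true} {false} _  = refl
  ⟦⟧*⟦⟧-zero {false} {b} _     = ℤₚ.*-zeroˡ ⟦ b ⟧

  -- The (v, u) entry of the product M S counts the members of the set S_u in the row v of M;
  -- the hypotheses say M S = J − I. Then M is injective, S M = J − I as well, and M has constant row and column sums.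
  module Complementary {m : ℕ} (M S : Fin (suc (suc m)) → Fin (suc (suc m)) → Bool)
    (hits   : ∀ v u → v ≢ u → ∃ λ p → M v p ≡ true × S u p ≡ true × (∀ i → M v i ≡ true → S u i ≡ true → i ≡ p))
    (misses : ∀ v i → M v i ≡ true → S v i ≡ true → ⊥) where

    private
      V = Fin (suc (suc m))

    -- The common row sum of J - I, one less than the order; it is nonzero because the order is at
    -- least two.
    c : ℤ
    c = + suc m

    -- The entries of J - I.
    off : V → V → ℤ
    off v u with u Finₚ.≟ v
    ... | yes _ = 0ℤ
    ... | no _  = 1ℤ

    off-same : ∀ v → off v v ≡ 0ℤ
    off-same v with v Finₚ.≟ v
    ... | yes _  = refl
    ... | no v≢v = ⊥-elim (v≢v refl)

    off-different : ∀ v u → u ≢ v → off v u ≡ 1ℤ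
    off-different v u u≢v with u Finₚ.≟ v
    ... | yes u≡v = ⊥-elim (u≢v u≡v)
    ... | no _    = refl

    sum-off : ∀ v (z : V → ℤ) → sum (λ u → off v u * z u) + z v ≡ sum z
    sum-off v z = sum-except z (λ u → off v u * z u) v
      (trans (cong (_* z v) (off-same v)) (ℤₚ.*-zeroˡ (z v)))
      (λ u u≢v → trans (cong (_* z u) (off-different v u u≢v)) (ℤₚ.*-identityˡ (z u)))

    MS : ∀ v u → sum (λ i → ⟦ M v i ⟧ * ⟦ S u i ⟧) ≡ off v u
    MS v u with u Finₚ.≟ v
    ... | yes refl = sum-zero λ i → ⟦⟧*⟦⟧-zero (misses v i)
    ... | no u≢v with hits v u (u≢v ∘ sym)
    ...   | p , Mp , Sp , unique = trans
      (sum-single (λ i → ⟦ M v i ⟧ * ⟦ S u i ⟧) p λ i i≢p → ⟦⟧*⟦⟧-zero λ Mi Si → i≢p (unique i Mi Si))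
      (cong₂ (λ a b → ⟦ a ⟧ * ⟦ b ⟧) Mp Sp)

    -- Associativity: M (S z) = (M S) z = J z - z, the sets `S u` being the columns of S.
    M∘S : ∀ v (z : V → ℤ) → sum (λ i → ⟦ M v i ⟧ * sum (λ u → ⟦ S u i ⟧ * z u)) + z v ≡ sum z
    M∘S v z = trans (cong (_+ z v) (trans (sum-product-comm (λ v i → ⟦ M v i ⟧) (λ i u → ⟦ S u i ⟧) z v)
      (sum-cong-≗ λ u → cong (_* z u) (MS v u)))) (sum-off v z)

    -- Appending x to the columns of S gives one column too many, hence a relation z₀ x + S w = 0.
    -- Applying M yields (J - I) w = 0, so every entry of w equals the sum of w, and w vanishes.
    -- Thus z₀ ≠ 0 and x = 0.
    M-injective : ∀ (x : V → ℤ) → (∀ v → sum (λ i → ⟦ M v i ⟧ * x i) ≡ 0ℤ) → ∀ i → x i ≡ 0ℤ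
    M-injective x Mx≡0 i with dependent (suc (suc m)) A
      where
      A : V → Fin (suc (suc (suc m))) → ℤ
      A i Fin.zero    = x i
      A i (Fin.suc u) = ⟦ S u i ⟧
    ... | z , (j , zj≢0) , solves = [ id , ⊥-elim ∘ z₀≢0 ]′ (ℤₚ.i*j≡0⇒i≡0∨j≡0 (x i) xi*z₀≡0)
      where
      z₀ = z Fin.zero
      w  = z ∘ Fin.suc
      split : ∀ a x z₀ y → a * (x * z₀ + y) ≡ a * x * z₀ + a * y
      split = solve-∀
      MSw≡0 : ∀ v → sum (λ i → ⟦ M v i ⟧ * sum (λ u → ⟦ S u i ⟧ * w u)) ≡ 0ℤ
      MSw≡0 v = begin
        sum (λ i → ⟦ M v i ⟧ * Sw i)
          ≡⟨ ℤₚ.+-identityˡ _ ⟨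
        0ℤ + sum (λ i → ⟦ M v i ⟧ * Sw i)
          ≡⟨ cong (_+ sum (λ i → ⟦ M v i ⟧ * Sw i)) (trans (cong (_* z₀) (Mx≡0 v)) (ℤₚ.*-zeroˡ z₀)) ⟨
        sum (λ i → ⟦ M v i ⟧ * x i) * z₀ + sum (λ i → ⟦ M v i ⟧ * Sw i)
          ≡⟨ cong (_+ sum (λ i → ⟦ M v i ⟧ * Sw i)) (*-distribʳ-sum z₀ (λ i → ⟦ M v i ⟧ * x i)) ⟩
        sum (λ i → ⟦ M v i ⟧ * x i * z₀) + sum (λ i → ⟦ M v i ⟧ * Sw i)
          ≡⟨ ∑-distrib-+ (λ i → ⟦ M v i ⟧ * x i * z₀) (λ i → ⟦ M v i ⟧ * Sw i) ⟨
        sum (λ i → ⟦ M v i ⟧ * x i * z₀ + ⟦ M v i ⟧ * Sw i)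
          ≡⟨ sum-zero (λ i → trans (sym (split ⟦ M v i ⟧ (x i) z₀ (Sw i))) (trans (cong (⟦ M v i ⟧ *_) (solves i)) (ℤₚ.*-zeroʳ ⟦ M v i ⟧))) ⟩
        0ℤ ∎
        where
        Sw : V → ℤ
        Sw i = sum (λ u → ⟦ S u i ⟧ * w u)
      w≡ : ∀ v → w v ≡ sum w
      w≡ v = trans (sym (ℤₚ.+-identityˡ (w v))) (trans (cong (_+ w v) (sym (MSw≡0 v))) (M∘S v w))
      cancel : ∀ k x → x ≡ (1ℤ + k) * x → k * x ≡ 0ℤ
      cancel k x eq = trans (difference k x) (trans (cong (_- x) (sym eq)) (ℤₚ.+-inverseʳ x))
        where
        difference : ∀ k x → k * x ≡ (1ℤ + k) * x - x
        difference = solve-∀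
      total≡0 : sum w ≡ 0ℤ
      total≡0 = [ (λ ()) , id ]′ (ℤₚ.i*j≡0⇒i≡0∨j≡0 c
        (cancel c (sum w) (trans (sum-cong-≗ w≡) (sum-constant (suc (suc m)) (sum w)))))
      w≡0 : ∀ v → w v ≡ 0ℤ
      w≡0 v = trans (w≡ v) total≡0
      z₀≢0 : z₀ ≢ 0ℤ
      z₀≢0 z₀≡0 = zj≢0 (all j)
        where
        all : ∀ j → z j ≡ 0ℤ
        all Fin.zero    = z₀≡0
        all (Fin.suc u) = w≡0 u
      xi*z₀≡0 : x i * z₀ ≡ 0ℤ
      xi*z₀≡0 = begin
        x i * z₀                                       ≡⟨ ℤₚ.+-identityʳ (x i * z₀) ⟨
        x i * z₀ + 0ℤ                                  ≡⟨ cong (_+_ (x i * z₀)) (sum-zero λ u → trans (cong (⟦ S u i ⟧ *_) (w≡0 u)) (ℤₚ.*-zeroʳ ⟦ S u i ⟧)) ⟨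
        x i * z₀ + sum (λ u → ⟦ S u i ⟧ * w u)         ≡⟨ solves i ⟩
        0ℤ                                             ∎

    column row size : V → ℤ
    column t = sum (λ v → ⟦ M v t ⟧)
    row v    = sum (λ x → ⟦ M v x ⟧)
    size i   = sum (λ u → ⟦ S u i ⟧)

    -- The (i, t) entry of S M, the product in the other order.
    joint : V → V → ℤ
    joint i t = sum (λ u → ⟦ S u i ⟧ * ⟦ M u t ⟧)

    δ : V → V → ℤ
    δ i t with i Finₚ.≟ t
    ... | yes _ = 1ℤ
    ... | no _  = 0ℤ

    δ-same : ∀ t → δ t t ≡ 1ℤ
    δ-same t with t Finₚ.≟ t
    ... | yes _  = refl
    ... | no t≢t = ⊥-elim (t≢t refl)

    δ-different : ∀ {i t} → i ≢ t → δ i t ≡ 0ℤ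
    δ-different {i} {t} i≢t with i Finₚ.≟ t
    ... | yes i≡t = ⊥-elim (i≢t i≡t)
    ... | no _    = refl

    -- The case z = 1 of `M∘S`: M (S 1) = (J - I) 1.
    M-size : ∀ v → sum (λ i → ⟦ M v i ⟧ * size i) ≡ c
    M-size v = drop-1 _ (begin
      sum (λ i → ⟦ M v i ⟧ * size i) + 1ℤ
        ≡⟨ cong (_+ 1ℤ) (sum-cong-≗ λ i → cong (⟦ M v i ⟧ *_) (sum-cong-≗ λ u → sym (ℤₚ.*-identityʳ ⟦ S u i ⟧))) ⟩
      sum (λ i → ⟦ M v i ⟧ * sum (λ u → ⟦ S u i ⟧ * 1ℤ)) + 1ℤ
        ≡⟨ M∘S v (λ _ → 1ℤ) ⟩
      sum {suc (suc m)} (λ _ → 1ℤ)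
        ≡⟨ sum-constant (suc (suc m)) 1ℤ ⟩
      + suc (suc m) * 1ℤ
        ≡⟨ ℤₚ.*-identityʳ (+ suc (suc m)) ⟩
      1ℤ + c ∎)
      where
      drop-1 : ∀ x → x + 1ℤ ≡ 1ℤ + c → x ≡ c
      drop-1 x eq = ∙-cancelʳ 1ℤ x c (trans eq (ℤₚ.+-comm 1ℤ c))

    sum-linear : ∀ (a f g h : V → ℤ) p q r →
      sum (λ i → a i * (p * f i + q * g i + r * h i)) ≡
      p * sum (λ i → a i * f i) + q * sum (λ i → a i * g i) + r * sum (λ i → a i * h i)
    sum-linear a f g h p q r = begin
      sum (λ i → a i * (p * f i + q * g i + r * h i))
        ≡⟨ sum-cong-≗ (λ i → expand (a i) (f i) (g i) (h i) p q r) ⟩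
      sum (λ i → p * (a i * f i) + q * (a i * g i) + r * (a i * h i))
        ≡⟨ ∑-distrib-+ (λ i → p * (a i * f i) + q * (a i * g i)) (λ i → r * (a i * h i)) ⟩
      sum (λ i → p * (a i * f i) + q * (a i * g i)) + sum (λ i → r * (a i * h i))
        ≡⟨ cong (_+ sum (λ i → r * (a i * h i))) (∑-distrib-+ (λ i → p * (a i * f i)) (λ i → q * (a i * g i))) ⟩
      sum (λ i → p * (a i * f i)) + sum (λ i → q * (a i * g i)) + sum (λ i → r * (a i * h i))
        ≡⟨ cong₂ _+_ (cong₂ _+_ (*-distribˡ-sum p (λ i → a i * f i)) (*-distribˡ-sum q (λ i → a i * g i))) (*-distribˡ-sum r (λ i → a i * h i)) ⟨
      p * sum (λ i → a i * f i) + q * sum (λ i → a i * g i) + r * sum (λ i → a i * h i) ∎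
      where
      expand : ∀ a f g h p q r → a * (p * f + q * g + r * h) ≡ p * (a * f) + q * (a * g) + r * (a * h)
      expand = solve-∀

    -- For fixed t, M sends the vector with entries c (S M)(i, t) - column t · size i + c δ(i, t) to
    -- c (column t - M v t) - column t · c + c M v t = 0, so the vector is zero by injectivity.
    -- Hence c (S M + I) has rank one.
    SM : ∀ i t → c * joint i t + c * δ i t ≡ column t * size i
    SM i t = trans (complete (c * joint i t) (column t) (size i) (c * δ i t))
        (trans (cong (_+ column t * size i) (M-injective (λ i → c * joint i t + - column t * size i + c * δ i t) kernel i)) (ℤₚ.+-identityˡ (column t * size i)))
      where
      complete : ∀ x q s z → x + z ≡ x + - q * s + z + q * s
      complete = solve-∀
      collect : ∀ c y q e → y + e ≡ q → c * y + - q * c + c * e ≡ 0ℤ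
      collect c y _ e refl = vanish c y e
        where
        vanish : ∀ c y e → c * y + - (y + e) * c + c * e ≡ 0ℤ
        vanish = solve-∀
      kernel : ∀ v → sum (λ i → ⟦ M v i ⟧ * (c * joint i t + - column t * size i + c * δ i t)) ≡ 0ℤ
      kernel v = begin
        sum (λ i → ⟦ M v i ⟧ * (c * joint i t + - column t * size i + c * δ i t))
          ≡⟨ sum-linear (λ i → ⟦ M v i ⟧) (λ i → joint i t) size (λ i → δ i t) c (- column t) c ⟩
        c * My + - column t * sum (λ i → ⟦ M v i ⟧ * size i) + c * sum (λ i → ⟦ M v i ⟧ * δ i t)
          ≡⟨ cong₂ (λ x y → c * My + - column t * x + c * y) (M-size v) Mδ ⟩
        c * My + - column t * c + c * ⟦ M v t ⟧
          ≡⟨ collect c My (column t) ⟦ M v t ⟧ (M∘S v (λ u → ⟦ M u t ⟧)) ⟩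
        0ℤ ∎
        where
        My = sum (λ i → ⟦ M v i ⟧ * joint i t)
        Mδ : sum (λ i → ⟦ M v i ⟧ * δ i t) ≡ ⟦ M v t ⟧
        Mδ = trans (sum-single (λ i → ⟦ M v i ⟧ * δ i t) t
            (λ i i≢t → trans (cong (⟦ M v i ⟧ *_) (δ-different i≢t)) (ℤₚ.*-zeroʳ ⟦ M v i ⟧)))
          (trans (cong (⟦ M v t ⟧ *_) (δ-same t)) (ℤₚ.*-identityʳ ⟦ M v t ⟧))

    -- The diagonal of S M vanishes by `misses`.
    column*size : ∀ t → column t * size t ≡ c
    column*size t = begin
      column t * size t              ≡⟨ SM t t ⟨
      c * joint t t + c * δ t t    ≡⟨ cong₂ (λ x y → c * x + c * y) (sum-zero λ u → ⟦⟧*⟦⟧-zero λ Sut Mut → misses u t Mut Sut) (δ-same t) ⟩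
      c * 0ℤ + c * 1ℤ                ≡⟨ simplify c ⟩
      c                              ∎
      where
      simplify : ∀ c → c * 0ℤ + c * 1ℤ ≡ c
      simplify = solve-∀

    factor-nonzero : ∀ {x y} → x * y ≡ c → x ≢ 0ℤ
    factor-nonzero {y = y} eq refl with () ← trans (sym eq) (ℤₚ.*-zeroˡ y)

    size-nonzero : ∀ t → size t ≢ 0ℤ
    size-nonzero t = factor-nonzero (trans (ℤₚ.*-comm (size t) (column t)) (column*size t))

    *-cancelˡ : ∀ x {y z} → x ≢ 0ℤ → x * y ≡ x * z → y ≡ z
    *-cancelˡ x {y} {z} x≢0 = ℤₚ.*-cancelˡ-≡ x y z {{Integer.≢-nonZero x≢0}}

    -- Off the diagonal `SM` reads c (S M)(i, t) = column t · size i; writing c as column t · size t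
    -- allows cancelling column t.
    size-multiple : ∀ i t → i ≢ t → size t * joint i t ≡ size i
    size-multiple i t i≢t = *-cancelˡ (column t) (factor-nonzero (column*size t)) (begin
      column t * (size t * joint i t)  ≡⟨ ℤₚ.*-assoc (column t) (size t) (joint i t) ⟨
      column t * size t * joint i t    ≡⟨ cong (_* joint i t) (column*size t) ⟩
      c * joint i t                    ≡⟨ pad c (joint i t) ⟩
      c * joint i t + c * 0ℤ           ≡⟨ cong (λ x → c * joint i t + c * x) (δ-different i≢t) ⟨
      c * joint i t + c * δ i t        ≡⟨ SM i t ⟩
      column t * size i                  ∎)
      where
      pad : ∀ c y → c * y ≡ c * y + c * 0ℤ
      pad = solve-∀

    -- `size t` divides the nonzero `size i`; used in both directions, this makes all sizes equal.
    size-≤ : ∀ i t → ∣ size t ∣ ℕ.≤ ∣ size i ∣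
    size-≤ i t with i Finₚ.≟ t
    ... | yes refl = ℕₚ.≤-refl
    ... | no i≢t with ∣ joint i t ∣ in eq
    ...   | zero = ⊥-elim (size-nonzero i (trans (sym (size-multiple i t i≢t))
            (trans (cong (size t *_) (ℤₚ.∣i∣≡0⇒i≡0 eq)) (ℤₚ.*-zeroʳ (size t)))))
    ...   | suc k = subst (∣ size t ∣ ℕ.≤_)
            (trans (cong (∣ size t ∣ ℕ.*_) (sym eq)) (trans (sym (ℤₚ.abs-* (size t) (joint i t))) (cong ∣_∣ (size-multiple i t i≢t))))
            (ℕₚ.m≤m*n ∣ size t ∣ (suc k))

    size-constant : ∀ i t → size i ≡ size t
    size-constant i t with sum-natural (λ u → ⟦⟧-natural (S u i)) | sum-natural (λ u → ⟦⟧-natural (S u t))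
    ... | k , eq | l , eq′ = trans eq (trans (cong +_ (ℕₚ.≤-antisym
      (subst₂ ℕ._≤_ (cong ∣_∣ eq) (cong ∣_∣ eq′) (size-≤ t i))
      (subst₂ ℕ._≤_ (cong ∣_∣ eq′) (cong ∣_∣ eq) (size-≤ i t)))) (sym eq′))

    -- As size is constant, `M-size` says row v · size = c, and column t · size is c as well.
    row≡column : ∀ v t → row v ≡ column t
    row≡column v t = *-cancelˡ (size t) (size-nonzero t) (begin
      size t * row v                       ≡⟨ ℤₚ.*-comm (size t) (row v) ⟩
      row v * size t                       ≡⟨ *-distribʳ-sum (size t) (λ x → ⟦ M v x ⟧) ⟩
      sum (λ x → ⟦ M v x ⟧ * size t)       ≡⟨ sum-cong-≗ (λ x → cong (⟦ M v x ⟧ *_) (size-constant t x)) ⟩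
      sum (λ x → ⟦ M v x ⟧ * size x)       ≡⟨ M-size v ⟩
      c                                    ≡⟨ column*size t ⟨
      column t * size t                    ≡⟨ ℤₚ.*-comm (column t) (size t) ⟩
      size t * column t                    ∎)

    -- Both sets have the same cardinality, so the indicator of the excess of the column over the
    -- row sums to zero and vanishes.
    row⊆column⇒column⊆row : ∀ v t → (∀ x → M v x ≡ true → M x t ≡ true) → ∀ x → M x t ≡ true → M v x ≡ true
    row⊆column⇒column⊆row v t row⊆column x Mxt = conclude (M v x) (M x t) Mxt
        (natural-sum-zero {f = λ x → ⟦ M x t ∧ not (M v x) ⟧} (λ x → ⟦⟧-natural (M x t ∧ not (M v x))) excess≡0 x)
      where
      split : ∀ a b → (a ≡ true → b ≡ true) → ⟦ b ⟧ ≡ ⟦ a ⟧ + ⟦ b ∧ not a ⟧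
      split true  true  _   = refl
      split true  false a⇒b with () ← a⇒b refl
      split false true  _   = refl
      split false false _   = refl
      conclude : ∀ a b → b ≡ true → ⟦ b ∧ not a ⟧ ≡ 0ℤ → a ≡ true
      conclude true  _    _ _ = refl
      conclude false true _ ()
      excess≡0 : sum (λ x → ⟦ M x t ∧ not (M v x) ⟧) ≡ 0ℤ
      excess≡0 = ∙-cancelˡ (row v) (sum (λ x → ⟦ M x t ∧ not (M v x) ⟧)) 0ℤ (begin
        row v + sum (λ x → ⟦ M x t ∧ not (M v x) ⟧)    ≡⟨ ∑-distrib-+ (λ x → ⟦ M v x ⟧) (λ x → ⟦ M x t ∧ not (M v x) ⟧) ⟨
        sum (λ x → ⟦ M v x ⟧ + ⟦ M x t ∧ not (M v x) ⟧) ≡⟨ sum-cong-≗ (λ x → split (M v x) (M x t) (row⊆column x)) ⟨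
        column t                                       ≡⟨ row≡column v t ⟨
        row v                                          ≡⟨ ℤₚ.+-identityʳ (row v) ⟨
        row v + 0ℤ                                     ∎)

-- Circulant digraphs

open import Data.Nat
open import Data.Nat.DivMod using (_mod_; [m+n]%n≡m%n; m<n⇒m%n≡m; m/n*n≤m; m≡m%n+[m/n]*n; m%n<n)
open import Data.Nat.Induction using (<-rec)
open import Data.Nat.Properties
open import Data.Nat.Tactic.RingSolver using (solve; solve-∀)
open import Data.List using ([]; _∷_)

true≢false : ∀ {b} → b ≡ true → b ≡ false → ⊥
true≢false refl ()

≢true⇒false : ∀ {b} → b ≢ true → b ≡ false
≢true⇒false = Boolₚ.¬-not

≡ᵇ-true : ∀ {m n} → m ≡ n → (m ≡ᵇ n) ≡ true
≡ᵇ-true {zero} refl = refl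
≡ᵇ-true {suc m} refl = ≡ᵇ-true {m} refl

≡ᵇ-false : ∀ {m n} → m ≢ n → (m ≡ᵇ n) ≡ false
≡ᵇ-false {m} {n} m≢n with m ≡ᵇ n in eq
... | true  = ⊥-elim (m≢n (≡ᵇ⇒≡ m n (subst T (sym eq) tt)))
... | false = refl

≤ᵇ-true : ∀ {m n} → m ≤ n → (m ≤ᵇ n) ≡ true
≤ᵇ-true {m} {n} m≤n with m ≤ᵇ n in eq
... | true  = refl
... | false = ⊥-elim (subst T eq (≤⇒≤ᵇ m≤n))

≤ᵇ-false : ∀ {m n} → n < m → (m ≤ᵇ n) ≡ false
≤ᵇ-false {m} {n} n<m with m ≤ᵇ n in eq
... | true  = ⊥-elim (<⇒≱ n<m (≤ᵇ⇒≤ m n (subst T (sym eq) tt)))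
... | false = refl

diffMod-< : ∀ m (i j : Fin m) → toℕ i < toℕ j → diffMod m i j ≡ toℕ j ∸ toℕ i
diffMod-< (suc k) i j i<j = begin
  (toℕ j + suc k ∸ toℕ i) % suc k    ≡⟨ cong (_% suc k) (+-∸-comm (suc k) (<⇒≤ i<j)) ⟩
  (toℕ j ∸ toℕ i + suc k) % suc k    ≡⟨ [m+n]%n≡m%n (toℕ j ∸ toℕ i) (suc k) ⟩
  (toℕ j ∸ toℕ i) % suc k            ≡⟨ m<n⇒m%n≡m (≤-<-trans (m∸n≤m (toℕ j) (toℕ i)) (toℕ<n j)) ⟩
  toℕ j ∸ toℕ i                      ∎
  where open ≡-Reasoning

diffMod-> : ∀ m (i j : Fin m) → toℕ j < toℕ i → diffMod m i j ≡ toℕ j + m ∸ toℕ i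
diffMod-> (suc k) i j j<i = m<n⇒m%n≡m (+-cancelʳ-< (toℕ i) _ _ (begin-strict
  toℕ j + suc k ∸ toℕ i + toℕ i  ≡⟨ m∸n+n≡m (≤-trans (<⇒≤ (toℕ<n i)) (m≤n+m (suc k) (toℕ j))) ⟩
  toℕ j + suc k                  <⟨ +-monoˡ-< (suc k) j<i ⟩
  toℕ i + suc k                  ≡⟨ +-comm (toℕ i) (suc k) ⟩
  suc k + toℕ i                  ∎))
  where open ≤-Reasoning

-- Successor in ℤ_m on representatives, with the wrap-around spelled out.
Next : ℕ → ℕ → ℕ → Set
Next m x y = y ≡ suc x ⊎ (suc x ≡ m × y ≡ 0)

-- The values of `diffMod` at distinct representatives, as additive equations free of truncated
-- subtraction and remainders.
Distance : ℕ → ℕ → ℕ → ℕ → Set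
Distance m x y d = (x < y × d + x ≡ y) ⊎ (y < x × d + x ≡ y + m)

diffMod-distance : ∀ m (i j : Fin m) → i ≢ j → Distance m (toℕ i) (toℕ j) (diffMod m i j)
diffMod-distance m i j i≢j with <-cmp (toℕ i) (toℕ j)
... | tri< i<j _ _ = inj₁ (i<j , trans (cong (_+ toℕ i) (diffMod-< m i j i<j)) (m∸n+n≡m (<⇒≤ i<j)))
... | tri≈ _ i≡j _ = ⊥-elim (i≢j (toℕ-injective i≡j))
... | tri> _ _ j<i = inj₂ (j<i , trans (cong (_+ toℕ i) (diffMod-> m i j j<i))
        (m∸n+n≡m (≤-trans (<⇒≤ (toℕ<n i)) (m≤n+m m (toℕ j)))))

distance-positive : ∀ {m x y d} → x < m → Distance m x y d → 1 ≤ d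
distance-positive {d = suc d} _ _ = s≤s z≤n
distance-positive {d = zero} x<m (inj₁ (x<y , refl)) = ⊥-elim (<-irrefl refl x<y)
distance-positive {m} {y = y} {d = zero} x<m (inj₂ (y<x , refl)) = ⊥-elim (<⇒≱ x<m (m≤n+m m y))

distance-bounded : ∀ {m x y d} → y < m → Distance m x y d → d < m
distance-bounded {x = x} {d = d} y<m (inj₁ (x<y , refl)) = ≤-<-trans (m≤m+n d x) y<m
distance-bounded {m} {x} {y} {d} y<m (inj₂ (y<x , eq)) = +-cancelʳ-< x d m
  (subst (_< m + x) (sym eq) (subst (_< m + x) (+-comm m y) (+-monoʳ-< m y<x)))

distance-1⇒Next : ∀ {m x y d} → x < m → Distance m x y d → d ≡ 1 → Next m x y
distance-1⇒Next x<m (inj₁ (_ , eq)) refl = inj₁ (sym eq)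
distance-1⇒Next {m} {y = zero} x<m (inj₂ (_ , eq)) refl = inj₂ (eq , refl)
distance-1⇒Next {m} {y = suc y} x<m (inj₂ (_ , refl)) refl = ⊥-elim (<⇒≱ x<m (m≤n+m m y))

Next⇒distance-1 : ∀ {m x y d} → y < m → Distance m x y d → Next m x y → d ≡ 1
Next⇒distance-1 {x = x} {d = d} y<m (inj₁ (_ , eq)) (inj₁ refl) = +-cancelʳ-≡ x d 1 eq
Next⇒distance-1 y<m (inj₁ (() , _)) (inj₂ (_ , refl))
Next⇒distance-1 y<m (inj₂ (y<x , _)) (inj₁ refl) = ⊥-elim (<-asym y<x (n<1+n _))
Next⇒distance-1 {x = x} {d = d} y<m (inj₂ (_ , eq)) (inj₂ (refl , refl)) = +-cancelʳ-≡ x d 1 eq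

distance-m-1⇒Next : ∀ {m x y d} → y < m → Distance m x y d → suc d ≡ m → Next m y x
distance-m-1⇒Next {x = zero} y<m (inj₁ (_ , refl)) refl = inj₂ (cong suc (+-identityʳ _) , refl)
distance-m-1⇒Next {x = suc x} {d = d} y<m (inj₁ (_ , refl)) refl = ⊥-elim (m+1+n≰m d (≤-pred y<m))
distance-m-1⇒Next {x = x} {y} {d} y<m (inj₂ (_ , eq)) refl =
  inj₁ (+-cancelˡ-≡ d x (suc y) (trans eq (trans (+-suc y d) (trans (cong suc (+-comm y d)) (sym (+-suc d y))))))

Next⇒distance-m-1 : ∀ {m x y d} → x < m → Distance m x y d → Next m y x → suc d ≡ m
Next⇒distance-m-1 x<m (inj₁ (x<y , _)) (inj₁ refl) = ⊥-elim (<-asym x<y (n<1+n _))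
Next⇒distance-m-1 x<m (inj₁ (_ , eq)) (inj₂ (refl , refl)) = cong suc (trans (sym (+-identityʳ _)) eq)
Next⇒distance-m-1 {m} {y = y} {d} x<m (inj₂ (_ , eq)) (inj₁ refl) =
  +-cancelʳ-≡ y (suc d) m (trans (sym (+-suc d y)) (trans eq (+-comm y m)))
Next⇒distance-m-1 x<m (inj₂ (() , _)) (inj₂ (_ , refl))

circArc-off-diagonal : ∀ m J (i j : Fin m) → i ≢ j → circArc m J i j ≡ J (diffMod m i j)
circArc-off-diagonal m J i j i≢j
  rewrite ≡ᵇ-false {diffMod m i j} {0} (λ eq → <⇒≢ (distance-positive (toℕ<n i) (diffMod-distance m i j i≢j)) (sym eq)) = refl

circArc⇒≢ : ∀ m J {i j : Fin m} → circArc m J i j ≡ true → i ≢ j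
circArc⇒≢ m J {i} arc refl = true≢false arc (circArc-loopless m J i)

dirCycle-arc⇒Next : ∀ m {i j : Fin m} → circArc m dirCycleJ i j ≡ true → Next m (toℕ i) (toℕ j)
dirCycle-arc⇒Next m {i} {j} arc = distance-1⇒Next (toℕ<n i) (diffMod-distance m i j i≢j)
  (≡ᵇ⇒≡ _ 1 (subst T (sym (trans (sym (circArc-off-diagonal m dirCycleJ i j i≢j)) arc)) tt))
  where i≢j = circArc⇒≢ m dirCycleJ {i} {j} arc

Next⇒≢ : ∀ {m x y} → 2 ≤ m → Next m x y → x ≢ y
Next⇒≢ _ (inj₁ ()) refl
Next⇒≢ (s≤s ()) (inj₂ (refl , refl)) refl

Next⇒dirCycle-arc : ∀ m {i j : Fin m} → 2 ≤ m → Next m (toℕ i) (toℕ j) → circArc m dirCycleJ i j ≡ true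
Next⇒dirCycle-arc m {i} {j} 2≤m next = trans (circArc-off-diagonal m dirCycleJ i j i≢j)
  (≡ᵇ-true (Next⇒distance-1 (toℕ<n j) (diffMod-distance m i j i≢j) next))
  where i≢j = λ i≡j → Next⇒≢ 2≤m next (cong toℕ i≡j)

half-bounds : ∀ m → (m / 2) + (m / 2) ≤ m × m ≤ suc ((m / 2) + (m / 2))
half-bounds m = (begin
    m / 2 + m / 2             ≡⟨ eq ⟩
    m / 2 * 2                 ≤⟨ m/n*n≤m m 2 ⟩
    m                         ∎) , (begin
    m                         ≡⟨ m≡m%n+[m/n]*n m 2 ⟩
    m % 2 + m / 2 * 2         ≤⟨ +-monoˡ-≤ _ (≤-pred (m%n<n m 2)) ⟩
    suc (m / 2 * 2)           ≡⟨ cong suc eq ⟨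
    suc (m / 2 + m / 2)       ∎)
  where
  open ≤-Reasoning
  eq : m / 2 + m / 2 ≡ m / 2 * 2
  eq = trans (cong (m / 2 +_) (sym (+-identityʳ (m / 2)))) (*-comm 2 (m / 2))

∨-true : ∀ {a b} → a ≡ true ⊎ b ≡ true → (a ∨ b) ≡ true
∨-true (inj₁ refl) = refl
∨-true {a} (inj₂ refl) = Boolₚ.∨-zeroʳ a

-- For m ≥ 4 the set J = {1, ±2, ..., ±⌊m/2⌋} consists of all nonzero residues except m - 1, so the
-- circulant has every arc but the reversals of i → i + 1.
CnJ-true : ∀ m d → 4 ≤ m → 1 ≤ d → d < m → suc d ≢ m → CnJ m d ≡ true
CnJ-true m 1 4≤m _ _ _ = refl
CnJ-true m d@(suc (suc e)) 4≤m _ d<m d+1≢m with d ≤? m / 2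
... | yes d≤h = ∨-true (inj₁ (cong₂ _∧_ {x = 2 ≤ᵇ d} refl (≤ᵇ-true d≤h)))
... | no d≰h = ∨-true {(2 ≤ᵇ d) ∧ (d ≤ᵇ m / 2)} (inj₂ (cong₂ _∧_ (≤ᵇ-true 2≤m-d) (≤ᵇ-true m-d≤h)))
  where
  2≤m-d : 2 ≤ m ∸ d
  2≤m-d = subst (_≤ m ∸ d) (m+n∸n≡m 2 d) (∸-monoˡ-≤ d (≤∧≢⇒< d<m d+1≢m))
  m-d≤h : m ∸ d ≤ m / 2
  m-d≤h = m≤n+o⇒m∸n≤o m d (≤-trans (proj₂ (half-bounds m)) (+-monoˡ-≤ (m / 2) (≰⇒> d≰h)))

d≤[1+d]/2⇒d≤1 : ∀ d → d ≤ suc d / 2 → d ≤ 1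
d≤[1+d]/2⇒d≤1 d d≤h = +-cancelˡ-≤ d d 1 (begin
  d + d                  ≤⟨ +-mono-≤ d≤h d≤h ⟩
  suc d / 2 + suc d / 2  ≤⟨ proj₁ (half-bounds (suc d)) ⟩
  suc d                  ≡⟨ +-comm 1 d ⟩
  d + 1                  ∎)
  where open ≤-Reasoning

-- The residue d = m - 1 is at least 3, hence different from 1 and larger than m/2, while m - d = 1
-- is less than 2.
CnJ-false : ∀ m d → 4 ≤ m → suc d ≡ m → CnJ m d ≡ false
CnJ-false m d (s≤s 3≤d) refl
  rewrite ≡ᵇ-false {d} {1} (λ { refl → <⇒≱ (s≤s (s≤s z≤n)) 3≤d })
  | ≤ᵇ-false {d} {suc d / 2} (≰⇒> (λ d≤h → <⇒≱ (s≤s (s≤s z≤n)) (≤-trans 3≤d (d≤[1+d]/2⇒d≤1 d d≤h))))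
  | Boolₚ.∧-zeroʳ (2 ≤ᵇ d)
  | m+n∸n≡m 1 d = refl

Cn-arc⇒¬Next : ∀ m {i j : Fin m} → 4 ≤ m → circArc m (CnJ m) i j ≡ true → ¬ Next m (toℕ j) (toℕ i)
Cn-arc⇒¬Next m {i} {j} 4≤m arc next = true≢false arc
  (trans (circArc-off-diagonal m (CnJ m) i j i≢j)
    (CnJ-false m _ 4≤m (Next⇒distance-m-1 (toℕ<n i) (diffMod-distance m i j i≢j) next)))
  where i≢j = circArc⇒≢ m (CnJ m) {i} {j} arc

¬Next⇒Cn-arc : ∀ m {i j : Fin m} → 4 ≤ m → i ≢ j → ¬ Next m (toℕ j) (toℕ i) → circArc m (CnJ m) i j ≡ true
¬Next⇒Cn-arc m {i} {j} 4≤m i≢j ¬next = trans (circArc-off-diagonal m (CnJ m) i j i≢j)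
  (CnJ-true m _ 4≤m (distance-positive (toℕ<n i) dist) (distance-bounded (toℕ<n j) dist)
    (λ eq → ¬next (distance-m-1⇒Next (toℕ<n j) dist eq)))
  where dist = diffMod-distance m i j i≢j

-- Injectivity comes for free: if c i = c j with i < j, then c j has an arc to c (i + 1), so i + 1
-- would follow j on the cycle.
DirectedCycle-embedding : ∀ (D : Digraph) m → 3 ≤ m → (c : ℕ → Fin (n D)) →
  (∀ i j → i < m → j < m → Next m i j → Arc D (c i) (c j)) →
  (∀ i j → i < m → j < m → Arc D (c i) (c j) → Next m i j) →
  InducedEmbedding (DirectedCycle m) D
DirectedCycle-embedding D m 3≤m c fwd bwd = record
  { f = λ i → c (toℕ i)
  ; f-inj = inj
  ; f-arc = λ u v → arcs-agree u v
  }
  where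
  2≤m = ≤-trans (n≤1+n 2) 3≤m

  earlier-distinct : ∀ i j → i < j → j < m → c i ≢ c j
  earlier-distinct i j i<j j<m ci≡cj
    with bwd j (suc i) j<m i+1<m (subst (λ x → Arc D x (c (suc i))) ci≡cj
           (fwd i (suc i) (<-trans i<j j<m) i+1<m (inj₁ refl)))
    where i+1<m = ≤-<-trans i<j j<m
  ... | inj₁ i+1≡j+1 = <⇒≢ i<j (suc-injective i+1≡j+1)

  inj : Injective _≡_ _≡_ (λ i → c (toℕ i))
  inj {u} {v} eq with <-cmp (toℕ u) (toℕ v)
  ... | tri< u<v _ _ = ⊥-elim (earlier-distinct _ _ u<v (toℕ<n v) eq)
  ... | tri≈ _ u≡v _ = toℕ-injective u≡v
  ... | tri> _ _ v<u = ⊥-elim (earlier-distinct _ _ v<u (toℕ<n u) (sym eq))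

  arcs-agree : ∀ u v → arc D (c (toℕ u)) (c (toℕ v)) ≡ circArc m dirCycleJ u v
  arcs-agree u v with circArc m dirCycleJ u v in eq
  ... | true  = fwd _ _ (toℕ<n u) (toℕ<n v) (dirCycle-arc⇒Next m eq)
  ... | false = ≢true⇒false (λ arc → true≢false
    (Next⇒dirCycle-arc m 2≤m (bwd _ _ (toℕ<n u) (toℕ<n v) arc)) eq)

Cn-embedding : ∀ (D : Digraph) m → 4 ≤ m → (c : ℕ → Fin (n D)) →
  (∀ i j → i < m → j < m → i ≢ j → c i ≢ c j) →
  (∀ i j → i < m → j < m → i ≢ j → ¬ Next m j i → Arc D (c i) (c j)) →
  (∀ i j → i < m → j < m → Arc D (c i) (c j) → ¬ Next m j i) →
  InducedEmbedding (Cn m) D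
Cn-embedding D m 4≤m c distinct fwd bwd = record
  { f = λ i → c (toℕ i)
  ; f-inj = λ {u} {v} eq → decidable-stable (u Finₚ.≟ v) (λ u≢v → distinct _ _ (toℕ<n u) (toℕ<n v) (u≢v ∘ toℕ-injective) eq)
  ; f-arc = λ u v → arcs-agree u v
  }
  where
  arcs-agree : ∀ u v → arc D (c (toℕ u)) (c (toℕ v)) ≡ circArc m (CnJ m) u v
  arcs-agree u v with circArc m (CnJ m) u v in eq
  ... | true  = fwd _ _ (toℕ<n u) (toℕ<n v) (λ u≡v → circArc⇒≢ m (CnJ m) {u} {v} eq (toℕ-injective u≡v)) (Cn-arc⇒¬Next m 4≤m eq)
  ... | false = ≢true⇒false (λ arc → true≢false
    (¬Next⇒Cn-arc m 4≤m (λ { refl → true≢false arc (loopless D _) }) (bwd _ _ (toℕ<n u) (toℕ<n v) arc)) eq)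

-- The forbidden digraphs have no kernel

Next-unique : ∀ {m x y z} → y < m → z < m → Next m x y → Next m x z → y ≡ z
Next-unique _ _ (inj₁ refl) (inj₁ refl) = refl
Next-unique y<m _ (inj₁ refl) (inj₂ (refl , _)) = ⊥-elim (<-irrefl refl y<m)
Next-unique _ z<m (inj₂ (refl , _)) (inj₁ refl) = ⊥-elim (<-irrefl refl z<m)
Next-unique _ _ (inj₂ (_ , refl)) (inj₂ (_ , refl)) = refl

-- Along the cycle a kernel contains exactly every other vertex, which is impossible for odd length.
DirectedCycle-no-kernel : ∀ k → ¬ HasKernel (DirectedCycle (suc (suc (suc (k + k)))))
DirectedCycle-no-kernel k (S , independent , absorbing) = flips-around
  where
  m = suc (suc (suc (k + k)))
  2≤m : 2 ≤ m
  2≤m = s≤s (s≤s z≤n)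

  flip : ∀ (u v : Fin m) → Next m (toℕ u) (toℕ v) → S v ≡ not (S u)
  flip u v next with S u in Su
  ... | true  = ≢true⇒false (λ Sv → independent u v Su Sv (Next⇒dirCycle-arc m 2≤m next))
  ... | false with absorbing u Su
  ... | w , Sw , arc = subst (λ x → S x ≡ true) (toℕ-injective (Next-unique (toℕ<n w) (toℕ<n v) (dirCycle-arc⇒Next m arc) next)) Sw

  even-agree : ∀ i (u : Fin m) → toℕ u ≡ i + i → S u ≡ S Fin.zero
  even-agree zero u eq = cong S (toℕ-injective eq)
  even-agree (suc i) u eq = trans (flip w u (inj₁ (trans u≡ (cong suc (sym (toℕ-fromℕ< w<m))))))
    (trans (cong not (flip v w (inj₁ (trans (toℕ-fromℕ< w<m) (cong suc (sym (toℕ-fromℕ< v<m)))))))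
    (trans (Boolₚ.not-involutive (S v)) (even-agree i v (toℕ-fromℕ< v<m))))
    where
    u≡ : toℕ u ≡ suc (suc (i + i))
    u≡ = trans eq (cong suc (+-suc i i))
    w<m : suc (i + i) < m
    w<m = <⇒≤ (subst (_< m) u≡ (toℕ<n u))
    v<m = <⇒≤ w<m
    v = fromℕ< v<m
    w = fromℕ< w<m

  flips-around : ⊥
  -- The last vertex has the even index 2(k + 1), so it agrees with vertex 0, yet it directly
  -- precedes vertex 0 on the cycle.
  flips-around = Boolₚ.not-¬ (sym (even-agree (suc k) last (trans last≡ (cong suc (sym (+-suc k k))))))
    (flip last Fin.zero (inj₂ (cong suc last≡ , refl)))
    where
    last = Fin.fromℕ (suc (suc (k + k)))
    last≡ = Finₚ.toℕ-fromℕ (suc (suc (k + k)))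

successor : ∀ m (i : Fin m) → Σ (Fin m) λ j → Next m (toℕ i) (toℕ j)
successor m@(suc _) i with suc (toℕ i) <? m
... | yes i+1<m = fromℕ< i+1<m , inj₁ (toℕ-fromℕ< i+1<m)
... | no i+1≮m  = Fin.zero , inj₂ (≤-antisym (toℕ<n i) (≮⇒≥ i+1≮m) , refl)

Next-asym : ∀ {m x y} → 4 ≤ m → Next m x y → ¬ Next m y x
Next-asym _ (inj₁ refl) (inj₁ eq) = <⇒≢ (≤-trans (n<1+n _) (n≤1+n _)) eq
Next-asym 4≤m (inj₁ refl) (inj₂ (refl , refl)) = <⇒≱ (s≤s (s≤s (s≤s z≤n))) 4≤m
Next-asym 4≤m (inj₂ (refl , refl)) (inj₁ refl) = <⇒≱ (s≤s (s≤s (s≤s z≤n))) 4≤m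
Next-asym 4≤m (inj₂ (refl , refl)) (inj₂ (refl , refl)) = <⇒≱ (s≤s (s≤s z≤n)) 4≤m

-- Any two vertices are adjacent, so a kernel is a single vertex; but the successor of i has no arc to i.
Cn-no-kernel : ∀ m → 4 ≤ m → ¬ HasKernel (Cn m)
Cn-no-kernel m@(suc _) 4≤m (S , independent , absorbing) = some-member (S Fin.zero) refl
  where
  2≤m = ≤-trans (s≤s (s≤s z≤n)) 4≤m
  singleton-fails : ∀ i → S i ≡ true → ⊥
  singleton-fails i Si with successor m i
  ... | j , next with S j in Sj
  ... | true = independent i j Si Sj (¬Next⇒Cn-arc m 4≤m (Next⇒≢ 2≤m next ∘ cong toℕ) (Next-asym 4≤m next))
  ... | false with absorbing j Sj
  ... | x , Sx , j→x = independent i x Si Sx (¬Next⇒Cn-arc m 4≤m i≢x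
      λ next-xi → independent x i Sx Si (¬Next⇒Cn-arc m 4≤m (i≢x ∘ sym) (Next-asym 4≤m next-xi)))
    where
    i≢x : i ≢ x
    i≢x refl = Cn-arc⇒¬Next m 4≤m j→x next

  some-member : ∀ b → S Fin.zero ≡ b → ⊥
  some-member true  S0 = singleton-fails Fin.zero S0
  some-member false S0 with absorbing Fin.zero S0
  ... | v , Sv , _ = singleton-fails v Sv

IsKernel? : ∀ D (S : Fin (n D) → Bool) → Dec (IsKernel D S)
IsKernel? D S =
  (Finₚ.all? λ u → Finₚ.all? λ v → (S u Boolₚ.≟ true) →-dec ((S v Boolₚ.≟ true) →-dec ¬? (arc D u v Boolₚ.≟ true)))
  ×-dec
  (Finₚ.all? λ u → (S u Boolₚ.≟ false) →-dec Finₚ.any? λ v → (S v Boolₚ.≟ true) ×-dec (arc D u v Boolₚ.≟ true))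

-- Stands in for function extensionality when a set is rebuilt from its vector of bits.
IsKernel-cong : ∀ D {S S′ : Fin (n D) → Bool} → S ≗ S′ → IsKernel D S → IsKernel D S′
IsKernel-cong D eq (independent , absorbing) =
  (λ u v Su Sv → independent u v (trans (eq u) Su) (trans (eq v) Sv)) ,
  (λ u Su → let v , Sv , u→v = absorbing u (trans (eq u) Su) in v , trans (sym (eq v)) Sv , u→v)

HasKernel? : ∀ D → Dec (HasKernel D)
HasKernel? D = map′
  (λ { (p , kernel) → lookup p , kernel })
  (λ { (S , kernel) → tabulate S , IsKernel-cong D (λ i → sym (lookup∘tabulate S i)) kernel })
  (anySubset? (λ p → IsKernel? D (lookup p)))

-- By evaluation over all vertex subsets.
C7-12-no-kernel : ¬ HasKernel C7-12
C7-12-no-kernel = toWitnessFalse {a? = HasKernel? C7-12} tt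

HasKernel-reflect : ∀ {H D} (e : InducedEmbedding H D) → HasKernel (induced D (n H) (InducedEmbedding.f e)) → HasKernel H
HasKernel-reflect e (S , independent , absorbing) =
  S , (λ u v Su Sv arc → independent u v Su Sv (trans (f-arc u v) arc)) ,
  (λ u Su → let v , Sv , arc = absorbing u Su in v , Sv , trans (sym (f-arc u v)) arc)
  where open InducedEmbedding e

-- Necessity, and heredity under induced subdigraphs

KP⇒¬Forbidden : ∀ D → KP D → ¬ Forbidden D
KP⇒¬Forbidden D (_ , kernels) = λ where
    (inj₁ (k , e))               → DirectedCycle-no-kernel k (restrict e)
    (inj₂ (inj₁ e))              → C7-12-no-kernel (restrict e)
    (inj₂ (inj₂ (m , 4≤m , e))) → Cn-no-kernel m 4≤m (restrict e)
  where
  restrict : ∀ {H} → InducedEmbedding H D → HasKernel H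
  restrict e = HasKernel-reflect e (kernels _ (InducedEmbedding.f e) (InducedEmbedding.f-inj e))

induced-embedding : ∀ {H} D m (g : Fin m → Fin (n D)) → Injective _≡_ _≡_ g →
  InducedEmbedding H (induced D m g) → InducedEmbedding H D
induced-embedding D m g g-inj e = record
  { f = g ∘ f ; f-inj = f-inj ∘ g-inj ; f-arc = f-arc }
  where open InducedEmbedding e

induced-Forbidden : ∀ D m (g : Fin m → Fin (n D)) → Injective _≡_ _≡_ g → Forbidden (induced D m g) → Forbidden D
induced-Forbidden D m g g-inj (inj₁ (k , e)) = inj₁ (k , induced-embedding D m g g-inj e)
induced-Forbidden D m g g-inj (inj₂ (inj₁ e)) = inj₂ (inj₁ (induced-embedding D m g g-inj e))
induced-Forbidden D m g g-inj (inj₂ (inj₂ (l , 4≤l , e))) = inj₂ (inj₂ (l , 4≤l , induced-embedding D m g g-inj e))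

induced-in : ∀ D m (g : Fin m → Fin (n D)) → Injective _≡_ _≡_ g → LocallyInSemicomplete D → LocallyInSemicomplete (induced D m g)
induced-in D m g g-inj in-semi w u v u→w v→w u≢v = in-semi (g w) (g u) (g v) u→w v→w (u≢v ∘ g-inj)

induced-out : ∀ D m (g : Fin m → Fin (n D)) → Injective _≡_ _≡_ g → LocallyOutSemicomplete D → LocallyOutSemicomplete (induced D m g)
induced-out D m g g-inj out-semi w u v w→u w→v u≢v = out-semi (g w) (g u) (g v) w→u w→v (u≢v ∘ g-inj)

-- Asymmetric closed walks in semicomplete sets

module Cliques (D : Digraph) where
  V : Set
  V = Fin (n D)

  Arc? : ∀ (u v : V) → Dec (Arc D u v)
  Arc? u v = arc D u v Boolₚ.≟ true

  Adj : V → V → Set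
  Adj u v = Arc D u v ⊎ Arc D v u

  Adj-sym : ∀ {u v} → Adj u v → Adj v u
  Adj-sym (inj₁ a) = inj₂ a
  Adj-sym (inj₂ a) = inj₁ a

  Asym : V → V → Set
  Asym u v = Arc D u v × ¬ Arc D v u

  Asym? : ∀ u v → Dec (Asym u v)
  Asym? u v = Arc? u v ×-dec ¬? (Arc? v u)

  Arc-irrefl : ∀ {u v} → u ≡ v → ¬ Arc D u v
  Arc-irrefl refl a = true≢false a (loopless D _)

  -- The walk visits c 0, ..., c L and has L + 1 arcs. `clique` ranges over all indices, also beyond
  -- L, so that re-indexed walks inherit it at once.
  record ClosedWalk (c : ℕ → V) (L : ℕ) : Set where
    field
      step   : ∀ i → i < L → Asym (c i) (c (suc i))
      close  : Asym (c L) (c 0)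
      clique : ∀ i j → c i ≡ c j ⊎ Adj (c i) (c j)
  open ClosedWalk

  -- A vertex repetition or an asymmetric chord shortens the walk.
  Shortcut : (c : ℕ → V) (L j i : ℕ) → Set
  Shortcut c L j i = c i ≡ c j ⊎ (Asym (c i) (c j) × j ≢ suc i) ⊎ (Asym (c j) (c i) × (i ≢ 0 ⊎ j ≢ L))

  Shortcut? : ∀ c L j i → Dec (Shortcut c L j i)
  Shortcut? c L j i = (c i Finₚ.≟ c j) ⊎-dec (Asym? (c i) (c j) ×-dec ¬? (j ≟ suc i))
    ⊎-dec (Asym? (c j) (c i) ×-dec (¬? (i ≟ 0) ⊎-dec ¬? (j ≟ L)))

  segment : ∀ {c L} → ClosedWalk c L → ∀ i L′ → i + L′ ≤ L → Asym (c (i + L′)) (c i) → ClosedWalk (λ x → c (i + x)) L′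
  segment {c} walk i L′ le back = record
    { step   = λ x x<L′ → subst (Asym (c (i + x)) ∘ c) (sym (+-suc i x)) (walk .step (i + x) (<-≤-trans (+-monoʳ-< i x<L′) le))
    ; close  = subst (Asym (c (i + L′)) ∘ c) (sym (+-identityʳ i)) back
    ; clique = λ x y → walk .clique (i + x) (i + y) }

  skip : (c : ℕ → V) (i d : ℕ) → ℕ → V
  skip c i d x with x ≤? i
  ... | yes _ = c x
  ... | no _  = c (x + d)

  skip-≤ : ∀ c i d {x} → x ≤ i → skip c i d x ≡ c x
  skip-≤ c i d {x} x≤i with x ≤? i
  ... | yes _  = refl
  ... | no x≰i = ⊥-elim (x≰i x≤i)

  skip-> : ∀ c i d {x} → i < x → skip c i d x ≡ c (x + d)
  skip-> c i d {x} i<x with x ≤? i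
  ... | yes x≤i = ⊥-elim (<⇒≱ i<x x≤i)
  ... | no _    = refl

  skip-index : ∀ c i d x → ∃ λ y → skip c i d x ≡ c y
  skip-index c i d x with x ≤? i
  ... | yes _ = x , refl
  ... | no _  = x + d , refl

  splice : ∀ {c} i d L′ → ClosedWalk c (L′ + d) → i < L′ → Asym (c i) (c (suc i + d)) → ClosedWalk (skip c i d) L′
  splice {c} i d L′ walk i<L′ chord = record
    { step   = steps
    ; close  = subst₂ Asym (sym (skip-> c i d i<L′)) (sym (skip-≤ c i d z≤n)) (walk .close)
    ; clique = λ x y → let (x′ , ex) = skip-index c i d x ; (y′ , ey) = skip-index c i d y in
        subst₂ (λ u v → u ≡ v ⊎ Adj u v) (sym ex) (sym ey) (walk .clique x′ y′) }
    where
    steps : ∀ x → x < L′ → Asym (skip c i d x) (skip c i d (suc x))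
    steps x x<L′ with <-cmp x i
    ... | tri< x<i _ _ = subst₂ Asym (sym (skip-≤ c i d (<⇒≤ x<i))) (sym (skip-≤ c i d x<i))
          (walk .step x (<-≤-trans x<L′ (m≤m+n L′ d)))
    ... | tri≈ _ refl _ = subst₂ Asym (sym (skip-≤ c i d ≤-refl)) (sym (skip-> c i d ≤-refl)) chord
    ... | tri> _ _ i<x = subst₂ Asym (sym (skip-> c i d i<x)) (sym (skip-> c i d (m<n⇒m<1+n i<x)))
          (walk .step (x + d) (+-monoˡ-< d x<L′))

  -- A repetition leaves the piece from i to j - 1, a forward chord bypasses the vertices between i
  -- and j, a backward chord closes the piece from i to j. The exclusions in `Shortcut` are the arcs
  -- of the walk itself.
  shorten : ∀ {c L i j} → ClosedWalk c L → i < j → j ≤ L → Shortcut c L j i →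
    ∃₂ λ c′ L′ → L′ < L × ClosedWalk c′ L′
  shorten {c} {L} {i} {suc j} walk (s≤s i≤j) j<L (inj₁ ci≡cj) =
    _ , j ∸ i , ≤-<-trans (m∸n≤m j i) j<L ,
    segment walk i (j ∸ i) (≤-trans (≤-reflexive i+[j-i]) (<⇒≤ j<L))
      (subst₂ Asym (cong c (sym i+[j-i])) (sym ci≡cj) (walk .step j j<L))
    where i+[j-i] = m+[n∸m]≡n i≤j
  shorten {c} {L} {i} {j} walk i<j j≤L (inj₂ (inj₁ (chord , j≢1+i))) =
    _ , L′ , L′<L , splice i d L′ (subst (ClosedWalk c) L≡ walk) i<L′ (subst (Asym (c i) ∘ c) j≡ chord)
    where
    d  = j ∸ suc i
    L′ = L ∸ d
    j≡ : j ≡ suc i + d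
    j≡ = sym (m+[n∸m]≡n i<j)
    d≤L = ≤-trans (m∸n≤m j (suc i)) j≤L
    L≡ : L ≡ L′ + d
    L≡ = sym (m∸n+n≡m d≤L)
    0<d : 0 < d
    0<d = m<n⇒0<n∸m (≤∧≢⇒< i<j (j≢1+i ∘ sym))
    L′<L : L′ < L
    L′<L = subst (L′ <_) (sym L≡) (subst (_< L′ + d) (+-identityʳ L′) (+-monoʳ-< L′ 0<d))
    i<L′ : i < L′
    i<L′ = +-cancelʳ-≤ d (suc i) L′ (subst₂ _≤_ j≡ L≡ j≤L)
  shorten {c} {L} {i} {j} walk i<j j≤L (inj₂ (inj₂ (chord , proper))) =
    _ , j ∸ i , smaller proper ,
    segment walk i (j ∸ i) (≤-trans (≤-reflexive i+[j-i]) j≤L) (subst (λ x → Asym (c x) (c i)) (sym i+[j-i]) chord)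
    where
    i+[j-i] = m+[n∸m]≡n (<⇒≤ i<j)
    smaller : i ≢ 0 ⊎ j ≢ L → j ∸ i < L
    smaller (inj₂ j≢L) = ≤-<-trans (m∸n≤m j i) (≤∧≢⇒< j≤L j≢L)
    smaller (inj₁ i≢0) = <-≤-trans (∸-monoʳ-< (n≢0⇒n>0 i≢0) (<⇒≤ i<j)) j≤L

  Next-3 : ∀ i j → i < 3 → j < 3 → i ≢ j → ¬ Next 3 i j → Next 3 j i
  Next-3 0 0 _ _ i≢j _ = ⊥-elim (i≢j refl)
  Next-3 0 1 _ _ _ ¬next = ⊥-elim (¬next (inj₁ refl))
  Next-3 0 2 _ _ _ _ = inj₂ (refl , refl)
  Next-3 1 0 _ _ _ _ = inj₁ refl
  Next-3 1 1 _ _ i≢j _ = ⊥-elim (i≢j refl)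
  Next-3 1 2 _ _ _ ¬next = ⊥-elim (¬next (inj₁ refl))
  Next-3 2 0 _ _ _ ¬next = ⊥-elim (¬next (inj₂ (refl , refl)))
  Next-3 2 1 _ _ _ _ = inj₁ refl
  Next-3 2 2 _ _ i≢j _ = ⊥-elim (i≢j refl)
  Next-3 (suc (suc (suc _))) _ (s≤s (s≤s (s≤s ()))) _ _ _
  Next-3 _ (suc (suc (suc _))) _ (s≤s (s≤s (s≤s ()))) _ _

  -- Asymmetry excludes walks with one or two vertices. Without shortcuts the only asymmetric arcs
  -- are those of the walk, so all other pairs are joined in both directions: this is C₃ on three
  -- vertices and Cₘ(1, ±2, ...) on m ≥ 4.
  shortest⇒Forbidden : ∀ {c L} → ClosedWalk c L → (∀ i j → i < j → j ≤ L → ¬ Shortcut c L j i) → Forbidden D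
  shortest⇒Forbidden {c} {0} walk none = ⊥-elim (Arc-irrefl refl (proj₁ (walk .close)))
  shortest⇒Forbidden {c} {1} walk none = ⊥-elim (proj₂ (walk .close) (proj₁ (walk .step 0 (s≤s z≤n))))
  shortest⇒Forbidden {c} {L@(suc (suc L′))} walk none = go L′ refl
    where
    m = suc L
    along : ∀ i j → i < m → j < m → Next m i j → Asym (c i) (c j)
    along i j i<m j<m (inj₁ refl) = walk .step i (≤-pred j<m)
    along i j i<m j<m (inj₂ (refl , refl)) = walk .close

    distinct : ∀ i j → i < m → j < m → i ≢ j → c i ≢ c j
    distinct i j i<m j<m i≢j eq with <-cmp i j
    ... | tri< i<j _ _ = none i j i<j (≤-pred j<m) (inj₁ eq)
    ... | tri≈ _ i≡j _ = i≢j i≡j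
    ... | tri> _ _ j<i = none j i j<i (≤-pred i<m) (inj₁ (sym eq))

    asym⇒Next : ∀ i j → i < m → j < m → Asym (c i) (c j) → Next m i j
    asym⇒Next i j i<m j<m a with <-cmp i j
    ... | tri< i<j _ _ = inj₁ (decidable-stable (j ≟ suc i) λ j≢ → none i j i<j (≤-pred j<m) (inj₂ (inj₁ (a , j≢))))
    ... | tri≈ _ i≡j _ = ⊥-elim (Arc-irrefl (cong c i≡j) (proj₁ a))
    ... | tri> _ _ j<i = inj₂ (cong suc (decidable-stable (i ≟ L) λ i≢ → none j i j<i (≤-pred i<m) (inj₂ (inj₂ (a , inj₂ i≢)))) ,
            decidable-stable (j ≟ 0) λ j≢ → none j i j<i (≤-pred i<m) (inj₂ (inj₂ (a , inj₁ j≢))))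

    fwd : ∀ i j → i < m → j < m → i ≢ j → ¬ Next m j i → Arc D (c i) (c j)
    fwd i j i<m j<m i≢j ¬next = decidable-stable (Arc? (c i) (c j)) λ i↛j →
      [ distinct i j i<m j<m i≢j , [ i↛j , (λ j→i → ¬next (asym⇒Next j i j<m i<m (j→i , i↛j))) ]′ ]′ (walk .clique i j)

    bwd : ∀ i j → i < m → j < m → Arc D (c i) (c j) → ¬ Next m j i
    bwd i j i<m j<m i→j next = proj₂ (along j i j<m i<m next) i→j

    go : ∀ l → l ≡ L′ → Forbidden D
    go zero refl = inj₁ (0 , DirectedCycle-embedding D 3 ≤-refl c
      (λ i j i<m j<m next → proj₁ (along i j i<m j<m next))
      (λ i j i<m j<m i→j → decidable-stable ((j ≟ suc i) ⊎-dec ((suc i ≟ 3) ×-dec (j ≟ 0)))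
        λ ¬next → bwd i j i<m j<m i→j (Next-3 i j i<m j<m (λ i≡j → Arc-irrefl (cong c i≡j) i→j) ¬next)))
    go (suc l) refl = inj₂ (inj₂ (m , s≤s (s≤s (s≤s (s≤s z≤n))) ,
      Cn-embedding D m (s≤s (s≤s (s≤s (s≤s z≤n)))) c distinct fwd bwd))

  closed-walk⇒Forbidden : ∀ L c → ClosedWalk c L → Forbidden D
  closed-walk⇒Forbidden = <-rec _ λ L rec c walk →
    case L c rec walk (anyUpTo? (λ j → anyUpTo? (Shortcut? c L j) j) (suc L))
    where
    case : ∀ L c → (∀ {L′} → L′ < L → ∀ c′ → ClosedWalk c′ L′ → Forbidden D) → ClosedWalk c L →
      Dec (∃ λ j → j < suc L × ∃ λ i → i < j × Shortcut c L j i) → Forbidden D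
    case L c rec walk (yes (j , j<1+L , i , i<j , shortcut)) with shorten walk i<j (≤-pred j<1+L) shortcut
    ... | c′ , L′ , L′<L , walk′ = rec L′<L c′ walk′
    case L c rec walk (no none) =
      shortest⇒Forbidden walk λ i j i<j j≤L shortcut → none (j , s≤s j≤L , i , i<j , shortcut)

  -- A vertex repeats, and the steps between two visits form a closed walk.
  clique-sequence⇒Forbidden : (g : ℕ → V) → (∀ x → Asym (g x) (g (suc x))) →
    (∀ x y → g x ≡ g y ⊎ Adj (g x) (g y)) → Forbidden D
  clique-sequence⇒Forbidden g steps clique with Finₚ.pigeonhole (n<1+n (n D)) (g ∘ toℕ)
  ... | i , j , i<j , eq with toℕ j | i<j
  -- The walk ends at l, just before the repeated index, so that its closing arc is the step into g
  -- (l + 1) = g i.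
  ... | suc l | s≤s i≤l = closed-walk⇒Forbidden (l ∸ toℕ i) (λ x → g (toℕ i + x)) record
    { step   = λ x _ → subst (Asym (g (toℕ i + x)) ∘ g) (sym (+-suc (toℕ i) x)) (steps _)
    ; close  = subst₂ Asym (cong g (sym (m+[n∸m]≡n i≤l))) (trans (sym eq) (cong g (sym (+-identityʳ (toℕ i))))) (steps l)
    ; clique = λ x y → clique _ _ }

  triangle⇒Forbidden : ∀ {u v w} → Asym u v → Asym v w → Asym w u → Forbidden D
  triangle⇒Forbidden {u} {v} {w} uv vw wu = closed-walk⇒Forbidden 2 c record
    { step = λ { 0 _ → uv ; 1 _ → vw ; (suc (suc _)) (s≤s (s≤s ())) } ; close = wu ; clique = joined }
    where
    c : ℕ → V
    c 0 = u
    c 1 = v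
    c _ = w
    joined : ∀ i j → c i ≡ c j ⊎ Adj (c i) (c j)
    joined 0 0 = inj₁ refl
    joined 0 1 = inj₂ (inj₁ (proj₁ uv))
    joined 0 (suc (suc _)) = inj₂ (inj₂ (proj₁ wu))
    joined 1 0 = inj₂ (inj₂ (proj₁ uv))
    joined 1 1 = inj₁ refl
    joined 1 (suc (suc _)) = inj₂ (inj₁ (proj₁ vw))
    joined (suc (suc _)) 0 = inj₂ (inj₁ (proj₁ wu))
    joined (suc (suc _)) 1 = inj₂ (inj₂ (proj₁ vw))
    joined (suc (suc _)) (suc (suc _)) = inj₁ refl

  -- If P has no sink, each of its vertices receives no arc from some other vertex of P and so has
  -- an asymmetric arc to it; following these arcs gives an endless asymmetric walk in a
  -- semicomplete set.
  semicomplete-sink : ¬ Forbidden D → {P : V → Set} → (∀ v → Dec (P v)) → SemicompleteOn D P → ∃ P →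
    Σ V λ w → P w × (∀ x → P x → x ≢ w → Arc D x w)
  semicomplete-sink ¬forb {P} P? semi (v₀ , Pv₀)
    with Finₚ.any? (λ w → P? w ×-dec Finₚ.all? (λ x → P? x →-dec (¬? (x Finₚ.≟ w) →-dec Arc? x w)))
  ... | yes (w , Pw , all) = w , Pw , all
  ... | no no-sink = ⊥-elim (¬forb (clique-sequence⇒Forbidden (proj₁ ∘ g)
          (λ x → proj₂ (escape (g x))) (λ x y → pair (g x) (g y))))
    where
    escape : (w : ∃ P) → Σ (∃ P) λ x → Asym (proj₁ w) (proj₁ x)
    escape (w , Pw) with Finₚ.any? (λ x → P? x ×-dec (¬? (x Finₚ.≟ w) ×-dec ¬? (Arc? x w)))
    ... | yes (x , Px , x≢w , x↛w) = (x , Px) , [ id , ⊥-elim ∘ x↛w ]′ (semi w x Pw Px (x≢w ∘ sym)) , x↛w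
    ... | no none = ⊥-elim (no-sink (w , Pw , λ x Px x≢w →
            decidable-stable (Arc? x w) λ x↛w → none (x , Px , x≢w , x↛w)))
    g : ℕ → ∃ P
    g zero    = v₀ , Pv₀
    g (suc x) = proj₁ (escape (g x))
    pair : (u v : ∃ P) → proj₁ u ≡ proj₁ v ⊎ Adj (proj₁ u) (proj₁ v)
    pair (u , Pu) (v , Pv) with u Finₚ.≟ v
    ... | yes u≡v = inj₁ u≡v
    ... | no u≢v  = inj₂ (semi u v Pu Pv u≢v)

-- Sequences of token positions

alternate : {A : Set} → (ℕ → A) → (ℕ → A) → ℕ → A
alternate f g zero          = f 0
alternate f g (suc zero)    = g 0
alternate f g (suc (suc i)) = alternate (f ∘ suc) (g ∘ suc) i

alternate-even : ∀ {A : Set} (f g : ℕ → A) t → alternate f g (t + t) ≡ f t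
alternate-even f g zero = refl
alternate-even f g (suc t) rewrite +-suc t t = alternate-even (f ∘ suc) (g ∘ suc) t

alternate-odd : ∀ {A : Set} (f g : ℕ → A) t → alternate f g (suc (t + t)) ≡ g t
alternate-odd f g zero = refl
alternate-odd f g (suc t) rewrite +-suc t t = alternate-odd (f ∘ suc) (g ∘ suc) t

data Parity : ℕ → Set where
  even : ∀ t → Parity (t + t)
  odd  : ∀ t → Parity (suc (t + t))

parityView : ∀ i → Parity i
parityView zero = even 0
parityView (suc i) with parityView i
... | even t = odd t
... | odd t  = subst Parity (cong suc (+-suc t t)) (even (suc t))

double-injective : ∀ {s t} → s + s ≡ t + t → s ≡ t
double-injective {zero} {zero} _ = refl
double-injective {suc s} {suc t} eq =
  cong suc (double-injective (suc-injective (trans (sym (+-suc s s)) (trans (suc-injective eq) (+-suc t t)))))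

double≢1+double : ∀ s t → s + s ≢ suc (t + t)
double≢1+double (suc s) zero eq with () ← trans (sym (+-suc s s)) (suc-injective eq)
double≢1+double (suc s) (suc t) eq =
  double≢1+double s t (suc-injective (trans (sym (+-suc s s)) (trans (suc-injective eq) (cong suc (+-suc t t)))))

double-<⇒≤ : ∀ {s t} → s + s ≤ suc (t + t) → s ≤ t
double-<⇒≤ {zero} _ = z≤n
double-<⇒≤ {suc s} {zero} (s≤s le) = ⊥-elim (<⇒≱ (s≤s z≤n) (≤-trans (≤-reflexive (sym (+-suc s s))) le))
double-<⇒≤ {suc s} {suc t} le rewrite +-suc s s | +-suc t t = s≤s (double-<⇒≤ (≤-pred (≤-pred le)))

module Zigzag (D : Digraph) (k : ℕ) (P : ℕ → Fin (n D)) where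
  open Cliques D

  -- With arcs exactly p → p + k and p → p − k − 1 on the positions 0, …, 2k, the positions
  -- k, 2k, k − 1, 2k − 1, …, k + 1, 0 form an induced cycle.
  zigzag-cycle : 1 ≤ k →
    (∀ x → x ≤ k → Arc D (P x) (P (k + x))) → (∀ x → x < k → Arc D (P (suc k + x)) (P x)) →
    (∀ p q → p ≤ k + k → q ≤ k + k → Arc D (P p) (P q) → q ≡ k + p ⊎ p ≡ suc k + q) →
    InducedEmbedding (DirectedCycle (suc (k + k))) D
  zigzag-cycle 1≤k forward backward only = DirectedCycle-embedding D m (s≤s (+-mono-≤ 1≤k 1≤k)) c fwd bwd
    where
    m = suc (k + k)
    c = alternate (λ t → P (k ∸ t)) (λ t → P (k + (k ∸ t)))

    -- The even index 2t carries the position k - t = a, the odd index 2t + 1 the position k + (k -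
    -- t) = k + a + 1; equations replace the subtractions.
    data Place : ℕ → Set where
      low  : ∀ a t → a + t ≡ k → Place (t + t)
      high : ∀ a t → suc a + t ≡ k → Place (suc (t + t))

    position : ∀ {i} → Place i → ℕ
    position (low a t _)  = a
    position (high a t _) = k + suc a

    bounded : ∀ {i} (p : Place i) → position p ≤ k + k
    bounded (low a t eq)  = ≤-trans (subst (a ≤_) eq (m≤m+n a t)) (m≤m+n k k)
    bounded (high a t eq) = +-monoʳ-≤ k (subst (suc a ≤_) eq (m≤m+n (suc a) t))

    at : ∀ {i} (p : Place i) → c i ≡ P (position p)
    at (low a t refl)  = trans (alternate-even _ _ t) (cong P (m+n∸n≡m a t))
    at (high a t refl) = trans (alternate-odd _ (λ t → P (k + (k ∸ t))) t) (cong (λ x → P (k + x)) (m+n∸n≡m (suc a) t))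

    place : ∀ i → i < m → Place i
    place i i<m with parityView i
    ... | even t = low (k ∸ t) t (m∸n+n≡m (double-<⇒≤ {t} {k} (≤-trans (≤-pred i<m) (n≤1+n _))))
    ... | odd t  with k ∸ t in eq
    ...   | suc a = high a t (trans (cong (_+ t) (sym eq)) (m∸n+n≡m (double-<⇒≤ {t} {k} (≤-trans (n≤1+n _) (<⇒≤ i<m)))))
    ...   | zero  = ⊥-elim (<⇒≱ (≤-pred i<m) (+-mono-≤ {k} {t} (m∸n≡0⇒m≤n eq) (m∸n≡0⇒m≤n eq)))

    fwd′ : ∀ {i j} (p : Place i) (q : Place j) → Next m i j → Arc D (P (position p)) (P (position q))
    fwd′ (low a t e) (low b s e′) (inj₁ next) = ⊥-elim (double≢1+double s t next)
    fwd′ (low a t e) (high b s e′) (inj₁ next)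
      rewrite double-injective {s} {t} (suc-injective next) | +-cancelʳ-≡ t a (suc b) (trans e (sym e′)) = forward (suc b) (subst (suc b ≤_) e′ (m≤m+n (suc b) t))
    fwd′ (high a t e) (low b s e′) (inj₁ next)
      rewrite double-injective {s} {suc t} (trans next (cong suc (sym (+-suc t t))))
      | +-cancelʳ-≡ (suc t) a b (trans (+-suc a t) (trans e (sym e′)))
      | +-suc k b = backward b (subst (suc b ≤_) (trans (sym (+-suc b t)) e′) (m≤m+n (suc b) t))
    fwd′ (high a t e) (high b s e′) (inj₁ next) = ⊥-elim (double≢1+double s t (suc-injective next))
    -- The wrap from index 2k to index 0 is the arc from position 0 to position k.
    fwd′ (low a t e) (low b s e′) (inj₂ (last , first))
      rewrite double-injective {s} {0} first | double-injective {t} {k} (suc-injective last)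
      | +-identityʳ b | e′ | +-cancelʳ-≡ k a 0 e = subst (Arc D (P 0) ∘ P) (+-identityʳ k) (forward 0 z≤n)
    fwd′ (high a t e) (low b s e′) (inj₂ (last , _)) = ⊥-elim (double≢1+double k t (sym (suc-injective last)))

    beyond : ∀ {x y} → x ≡ suc k + y → x ≤ k → ⊥
    beyond {y = y} refl le = <⇒≱ (s≤s (m≤m+n k y)) le

    bwd′ : ∀ {i j} (p : Place i) (q : Place j) →
      position q ≡ k + position p ⊎ position p ≡ suc k + position q → Next m i j
    bwd′ (low a t e) (low b s e′) (inj₁ f)
      with refl ← m+n≡0⇒m≡0 a {s} (+-cancelˡ-≡ k (a + s) 0 (trans (sym (+-assoc k a s)) (trans (cong (_+ s) (sym f)) (trans e′ (sym (+-identityʳ k))))))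
      with refl ← +-cancelˡ-≡ k s 0 (trans (cong (_+ s) (trans (sym (+-identityʳ k)) (sym f))) (trans e′ (sym (+-identityʳ k))))
      with refl ← e = inj₂ (refl , refl)
    bwd′ (low a t e) (low b s e′) (inj₂ f) = ⊥-elim (beyond f (subst (a ≤_) e (m≤m+n a t)))
    bwd′ (low a t e) (high b s e′) (inj₁ f)
      with refl ← +-cancelˡ-≡ k (suc b) a f
      with refl ← +-cancelˡ-≡ (suc b) t s (trans e (sym e′)) = inj₁ refl
    bwd′ (low a t e) (high b s e′) (inj₂ f) = ⊥-elim (beyond f (subst (a ≤_) e (m≤m+n a t)))
    bwd′ (high a t e) (low b s e′) (inj₁ f) =
      ⊥-elim (beyond (trans f (trans (cong (k +_) (+-suc k a)) (+-suc k (k + a)))) (subst (b ≤_) e′ (m≤m+n b s)))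
    bwd′ (high a t e) (low b s e′) (inj₂ f)
      with refl ← +-cancelˡ-≡ k a b (suc-injective (trans (sym (+-suc k a)) f))
      with refl ← +-cancelˡ-≡ a s (suc t) (trans e′ (trans (sym e) (sym (+-suc a t)))) = inj₁ (cong suc (+-suc t t))
    bwd′ (high a t e) (high b s e′) (inj₁ f) =
      ⊥-elim (beyond (trans (+-cancelˡ-≡ k (suc b) (k + suc a) f) (+-suc k a)) (subst (suc b ≤_) e′ (m≤m+n (suc b) s)))
    bwd′ (high a t e) (high b s e′) (inj₂ f) =
      ⊥-elim (beyond (trans (+-cancelˡ-≡ k (suc a) (suc (k + suc b)) (trans f (sym (+-suc k (k + suc b))))) refl)
        (subst (suc a ≤_) e (m≤m+n (suc a) t)))

    fwd : ∀ i j → i < m → j < m → Next m i j → Arc D (c i) (c j)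
    fwd i j i<m j<m next = subst₂ (Arc D) (sym (at p)) (sym (at q)) (fwd′ p q next)
      where p = place i i<m ; q = place j j<m

    bwd : ∀ i j → i < m → j < m → Arc D (c i) (c j) → Next m i j
    bwd i j i<m j<m a = bwd′ p q (only _ _ (bounded p) (bounded q) (subst₂ (Arc D) (at p) (at q) a))
      where p = place i i<m ; q = place j j<m

module Windows (D : Digraph) (in-semi : LocallyInSemicomplete D) (¬forb : ¬ Forbidden D) where
  open Cliques D

  Apart : V → V → Set
  Apart u v = u ≢ v × ¬ Adj u v

  apart-sym : ∀ {u v} → Apart u v → Apart v u
  apart-sym (u≢v , ¬adj) = u≢v ∘ sym , ¬adj ∘ Adj-sym

  -- Two distinct in-neighbours of w would be adjacent. This is the main tool for excluding arcs
  -- between positions.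
  apart-in : ∀ {u v w} → Apart u v → Arc D v w → ¬ Arc D u w
  apart-in {u} {v} {w} (u≢v , ¬adj) v→w u→w = ¬adj (in-semi w u v u→w v→w u≢v)

  -- Positions 0, …, 2k of a sequence of token positions; without the chord the zigzag is an induced odd cycle.
  record Window (k : ℕ) (P : ℕ → V) : Set where
    field
      near     : ∀ x d → 0 < d → d < k → d + x ≤ k + k → Apart (P x) (P (d + x))
      forward  : ∀ x → x ≤ k → Asym (P x) (P (k + x))
      backward : ∀ x → x < k → Arc D (P (suc k + x)) (P x)

  module _ {k : ℕ} {P : ℕ → V} (window : Window (suc k) P) where
    open Window window
    private K = suc k

    -- Without this arc the positions 0, ..., 2K carry only the arcs x → x + K and x + K + 1 → x,
    -- and the zigzag is an induced cycle of length 2K + 1.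
    window-chord : Arc D (P 0) (P (K + K))
    window-chord = decidable-stable (Arc? _ _) λ no-chord → ¬forb (inj₁ (k ,
      subst (λ m → InducedEmbedding (DirectedCycle m) D) (cong (suc ∘ suc) (+-suc k k))
        (Zigzag.zigzag-cycle D K P (s≤s z≤n) (λ x x≤ → proj₁ (forward x x≤)) backward (only no-chord))))
      where
      ascending : ¬ Arc D (P 0) (P (K + K)) → ∀ p d → 0 < d → d + p ≤ K + K → Arc D (P p) (P (d + p)) → d ≡ K
      ascending no-chord p d 0<d le a with <-cmp d K
      ... | tri< d<K _ _ = ⊥-elim (proj₂ (near p d 0<d d<K le) (inj₁ a))
      ... | tri≈ _ d≡K _ = d≡K
      ... | tri> _ _ K<d with d ∸ K | m+[n∸m]≡n (<⇒≤ K<d)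
      -- Here d = K + e with 0 < e < K: `P p` and `P (e + p)` are apart but would share the
      -- out-neighbour `P (K + e + p)`.
      ...   | e | refl = ⊥-elim (apart-in (near p e 0<e e<K (≤-trans (m≤n+m (e + p) K) le′)) (proj₁ (forward (e + p) e+p≤K))
                (subst (λ y → Arc D (P p) (P y)) (+-assoc K e p) a))
        where
        le′ : K + (e + p) ≤ K + K
        le′ = subst (_≤ K + K) (+-assoc K e p) le
        e+p≤K = +-cancelˡ-≤ K (e + p) K le′
        0<e : 0 < e
        0<e = +-cancelˡ-< K 0 e (subst (_< K + e) (sym (+-identityʳ K)) K<d)
        -- For e = K only p = 0 fits into the window, and the arc is the excluded chord.
        e≢K : e ≢ K
        e≢K refl = no-chord (subst₂ (λ x y → Arc D (P x) (P y)) p≡0 (trans (cong (K + K +_) p≡0) (+-identityʳ (K + K))) a)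
          where
          p≡0 : p ≡ 0
          p≡0 = n≤0⇒n≡0 (+-cancelˡ-≤ K p 0 (≤-trans e+p≤K (≤-reflexive (sym (+-identityʳ K)))))
        e<K : e < K
        e<K = ≤∧≢⇒< (≤-trans (m≤m+n e p) e+p≤K) e≢K

      descending : ∀ q d → 0 < d → d + q ≤ K + K → Arc D (P (d + q)) (P q) → d ≡ suc K
      descending q d 0<d le a with <-cmp d (suc K)
      ... | tri≈ _ d≡ _ = d≡
      ... | tri< d<1+K _ _ with m≤n⇒m<n∨m≡n (≤-pred d<1+K)
      ...   | inj₁ d<K  = ⊥-elim (proj₂ (near q d 0<d d<K le) (inj₂ a))
      ...   | inj₂ refl = ⊥-elim (proj₂ (forward q (+-cancelˡ-≤ K q K le)) a)
      descending q d 0<d le a | tri> _ _ K<d with d ∸ suc K | m+[n∸m]≡n (<⇒≤ K<d)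
      -- Here d = K + 1 + e: `P (d + q)` and `P (K + 1 + q)` are apart but would share the
      -- out-neighbour `P q`.
      ... | e | refl = ⊥-elim (apart-in (apart-sym (near (suc K + q) e 0<e e<K (≤-trans (≤-reflexive shuffle) le)))
              (backward q q<K) (subst (λ y → Arc D (P y) (P q)) (sym shuffle) a))
        where
        shuffle : e + (suc K + q) ≡ suc K + e + q
        shuffle = trans (sym (+-assoc e (suc K) q)) (cong (_+ q) (+-comm e (suc K)))
        le′ : suc (e + q) ≤ K
        le′ = +-cancelˡ-≤ K (suc (e + q)) K (subst (_≤ K + K) (trans (+-assoc (suc K) e q) (sym (+-suc K (e + q)))) le)
        0<e : 0 < e
        0<e = +-cancelˡ-< (suc K) 0 e (subst (_< suc K + e) (sym (+-identityʳ (suc K))) K<d)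
        e<K : e < K
        e<K = ≤-trans (s≤s (m≤m+n e q)) le′
        q<K : q < K
        q<K = ≤-trans (s≤s (m≤n+m q e)) le′

      only : ¬ Arc D (P 0) (P (K + K)) → ∀ p q → p ≤ K + K → q ≤ K + K → Arc D (P p) (P q) → q ≡ K + p ⊎ p ≡ suc K + q
      only no-chord p q p≤ q≤ a with <-cmp p q
      ... | tri< p<q _ _ = inj₁ (trans (sym (m∸n+n≡m (<⇒≤ p<q))) (cong (_+ p)
              (ascending no-chord p (q ∸ p) (m<n⇒0<n∸m p<q) (subst (_≤ K + K) (sym (m∸n+n≡m (<⇒≤ p<q))) q≤)
                (subst (λ y → Arc D (P p) (P y)) (sym (m∸n+n≡m (<⇒≤ p<q))) a))))
      ... | tri≈ _ p≡q _ = ⊥-elim (Arc-irrefl (cong P p≡q) a)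
      ... | tri> _ _ q<p = inj₂ (trans (sym (m∸n+n≡m (<⇒≤ q<p))) (cong (_+ q)
              (descending q (p ∸ q) (m<n⇒0<n∸m q<p) (subst (_≤ K + K) (sym (m∸n+n≡m (<⇒≤ q<p))) p≤)
                (subst (λ y → Arc D (P y) (P q)) (sym (m∸n+n≡m (<⇒≤ q<p))) a))))

-- Endless rotations of at least two tokens

module Spirals (D : Digraph) (in-semi : LocallyInSemicomplete D) (¬forb : ¬ Forbidden D) where
  open Cliques D
  open Windows D in-semi ¬forb

  -- The endless form of a `Window`: in the application P x is the position left by the x-th move of
  -- the rotation, and `window-chord` supplies the chord at every x.
  record Spiral (k : ℕ) (P : ℕ → V) : Set where
    field
      near     : ∀ x d → 0 < d → d < k → Apart (P x) (P (d + x))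
      forward  : ∀ x → Asym (P x) (P (k + x))
      backward : ∀ x → Arc D (P (suc k + x)) (P x)
      chord    : ∀ x → Arc D (P x) (P (k + k + x))

  module SpiralArcs {k : ℕ} {P : ℕ → V} (2≤k : 2 ≤ k) (spiral : Spiral k P) where
    open Spiral spiral public

    at-most-k : ∀ {x y} d → y ≡ d + x → 0 < d → d < k → ¬ Adj (P x) (P y)
    at-most-k {x} d refl 0<d d<k = proj₂ (near x d 0<d d<k)

    no-forward : ∀ x e → 0 < e → e < k → ¬ Arc D (P x) (P (k + (e + x)))
    no-forward x e 0<e e<k = apart-in (near x e 0<e e<k) (proj₁ (forward (e + x)))

    no-backward : ∀ x e → 0 < e → e < k → ¬ Arc D (P (e + (suc k + x))) (P x)
    no-backward x e 0<e e<k = apart-in (apart-sym (near (suc k + x) e 0<e e<k)) (backward x)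

    backward-asym : ∀ x → Asym (P (suc k + x)) (P x)
    backward-asym x = backward x , λ a → no-forward x 1 (s≤s z≤n) 2≤k (subst (λ y → Arc D (P x) (P y)) (sym (+-suc k x)) a)

    chord-asym : ∀ x → Asym (P x) (P (k + k + x))
    -- Since 2k = (k - 1) + (k + 1), a reversed chord is the case e = k - 1 of `no-backward`.
    chord-asym x = chord x , λ a → no-backward x (pred k) (pred-mono-≤ 2≤k) (≤-reflexive suc-pred-k)
        (subst (λ y → Arc D (P y) (P x)) (eq k suc-pred-k) a)
      where
      suc-pred-k : suc (pred k) ≡ k
      suc-pred-k = suc-pred k {{>-nonZero (≤-trans (s≤s z≤n) 2≤k)}}
      eq : ∀ l → suc (pred k) ≡ l → k + k + x ≡ pred k + (suc k + x)
      eq _ _ = trans (+-assoc k k x) (trans (cong (_+ (k + x)) (sym suc-pred-k)) (sym (+-suc (pred k) (k + x))))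

    -- A backward arc of difference k + e has difference (k + 1) + (e - 1); e = 1 is left out
    -- because it is the arc `backward`.
    between-k-and-2k : ∀ {x y} e → y ≡ k + (e + x) → 2 ≤ e → e < k → ¬ Adj (P x) (P y)
    between-k-and-2k {x} e refl 2≤e e<k (inj₁ a) = no-forward x e (≤-trans (s≤s z≤n) 2≤e) e<k a
    between-k-and-2k {x} (suc e) refl 2≤e e<k (inj₂ a) = no-backward x e (≤-pred 2≤e) (<⇒≤ e<k)
      (subst (λ y → Arc D (P y) (P x)) eq a)
      where
      eq : k + (suc e + x) ≡ e + (suc k + x)
      eq = solve (k ∷ e ∷ x ∷ [])

    -- Both ends have arcs to `P (k + x)`, so they are adjacent. The ascending direction is excluded
    -- because the chord from `P (suc x)` has the same head and `P x`, `P (suc x)` are apart.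
    far-backward : ∀ x → Asym (P (suc (k + k) + x)) (P x)
    far-backward x = [ (λ a → ⊥-elim (wrong a)) , (λ a → a , wrong) ]′
        (in-semi (P (k + x)) (P x) (P (suc (k + k) + x)) (proj₁ (forward x))
          (subst (λ y → Arc D (P y) (P (k + x))) (cong suc (sym (+-assoc k k x))) (backward (k + x))) distinct)
      where
      chord′ : Arc D (P (suc x)) (P (suc (k + k) + x))
      chord′ = subst (λ y → Arc D (P (suc x)) (P y)) (+-suc (k + k) x) (chord (suc x))
      wrong : ¬ Arc D (P x) (P (suc (k + k) + x))
      wrong = apart-in (near x 1 (s≤s z≤n) 2≤k) chord′
      distinct : P x ≢ P (suc (k + k) + x)
      distinct eq = proj₂ (near x 1 (s≤s z≤n) 2≤k) (inj₂ (subst (Arc D (P (suc x))) (sym eq) chord′))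

    -- As for differences between k and 2k, with the chord in place of `forward` and `far-backward`
    -- in place of `backward`.
    beyond-2k : ∀ {x y} e → y ≡ k + (k + (e + x)) → 2 ≤ e → e < k → ¬ Adj (P x) (P y)
    beyond-2k {x} e refl 2≤e e<k (inj₁ a) = apart-in (near x e (≤-trans (s≤s z≤n) 2≤e) e<k)
      (subst (λ y → Arc D (P (e + x)) (P y)) (+-assoc k k (e + x)) (chord (e + x))) a
    beyond-2k {x} (suc e) refl 2≤e e<k (inj₂ a) =
      apart-in (apart-sym (near (suc (k + k) + x) e (≤-pred 2≤e) (<⇒≤ e<k))) (proj₁ (far-backward x))
        (subst (λ y → Arc D (P y) (P x)) eq a)
      where
      eq : k + (k + (suc e + x)) ≡ e + (suc (k + k) + x)
      eq = solve (k ∷ e ∷ x ∷ [])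

  -- The positions 0, …, 6 form C₇(2,4) ≅ C₇(1,2), unless 0 → 6, when 0 → 6 → 3 → 0 is a triangle.
  no-spiral-2 : ∀ {P} → ¬ Spiral 2 P
  no-spiral-2 {P} spiral = ¬forb (case (Arc? (P 0) (P 6)))
    where
    open SpiralArcs ≤-refl spiral
    -- Positions 5 and 6 are apart, and 5 → 0.
    no-6-0 : ¬ Arc D (P 6) (P 0)
    no-6-0 = apart-in (apart-sym (near 5 1 (s≤s z≤n) ≤-refl)) (proj₁ (far-backward 0))

    -- The arcs of C₇(2, 4) by the difference of the representatives; a descending arc of difference
    -- 3 or 5 is a step of 4 or 2 modulo 7.
    up down : ℕ → Bool
    up d   = (d ≡ᵇ 2) ∨ (d ≡ᵇ 4)
    down d = (d ≡ᵇ 3) ∨ (d ≡ᵇ 5)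

    record Agree (d x : ℕ) : Set where
      constructor agree
      field
        distinct   : P x ≢ P (d + x)
        ascending  : arc D (P x) (P (d + x)) ≡ up d
        descending : arc D (P (d + x)) (P x) ≡ down d
    open Agree

    forwards : ∀ {d x} → up d ≡ true → down d ≡ false → Asym (P x) (P (d + x)) → Agree d x
    forwards u d a = agree (λ eq → Arc-irrefl eq (proj₁ a)) (trans (proj₁ a) (sym u)) (trans (≢true⇒false (proj₂ a)) (sym d))

    backwards : ∀ {d x} → up d ≡ false → down d ≡ true → Asym (P (d + x)) (P x) → Agree d x
    backwards u d a = agree (λ eq → Arc-irrefl (sym eq) (proj₁ a)) (trans (≢true⇒false (proj₂ a)) (sym u)) (trans (proj₁ a) (sym d))

    neither : ∀ {d x} → up d ≡ false → down d ≡ false → Apart (P x) (P (d + x)) → Agree d x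
    neither u d a = agree (proj₁ a) (trans (≢true⇒false (proj₂ a ∘ inj₁)) (sym u)) (trans (≢true⇒false (proj₂ a ∘ inj₂)) (sym d))

    agreement : ¬ Arc D (P 0) (P 6) → ∀ d x → 0 < d → d + x ≤ 6 → Agree d x
    agreement ¬a 1 x _ _ = neither refl refl (near x 1 (s≤s z≤n) ≤-refl)
    agreement ¬a 2 x _ _ = forwards refl refl (forward x)
    agreement ¬a 3 x _ _ = backwards refl refl (backward-asym x)
    agreement ¬a 4 x _ _ = forwards refl refl (chord-asym x)
    agreement ¬a 5 x _ _ = backwards refl refl (far-backward x)
    -- Positions 0 and 6 are different vertices because 0 → 2 while the chord 2 → 6 is asymmetric.
    agreement ¬a 6 zero _ _ = neither refl refl
      ((λ eq → proj₂ (chord-asym 2) (subst (λ v → Arc D v (P 2)) eq (proj₁ (forward 0)))) , [ ¬a , no-6-0 ]′)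
    agreement ¬a 6 (suc x) _ (s≤s (s≤s (s≤s (s≤s (s≤s (s≤s ()))))))
    agreement ¬a (suc (suc (suc (suc (suc (suc (suc _))))))) x _ (s≤s (s≤s (s≤s (s≤s (s≤s (s≤s ()))))))

    agreement′ : ¬ Arc D (P 0) (P 6) → ∀ {x y} → x < y → y ≤ 6 → ∃ λ d → (y ∸ x ≡ d) × Agree d x × y ≡ d + x
    agreement′ ¬a {x} {y} x<y y≤6 = y ∸ x , refl ,
        agreement ¬a (y ∸ x) x (m<n⇒0<n∸m x<y) (subst (_≤ 6) (sym y≡) y≤6) , sym y≡
      where y≡ = m∸n+n≡m (<⇒≤ x<y)

    C₇-arc : ℕ → ℕ → Bool
    C₇-arc x y with <-cmp x y
    ... | tri< _ _ _ = up (y ∸ x)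
    ... | tri≈ _ _ _ = false
    ... | tri> _ _ _ = down (x ∸ y)

    arcs-agree : ¬ Arc D (P 0) (P 6) → ∀ x y → x ≤ 6 → y ≤ 6 → arc D (P x) (P y) ≡ C₇-arc x y
    arcs-agree ¬a x y x≤6 y≤6 with <-cmp x y
    ... | tri≈ _ refl _ = loopless D _
    ... | tri< x<y _ _ with agreement′ ¬a x<y y≤6
    ...   | d , eq , ag , refl = trans (ag .ascending) (cong up (sym eq))
    arcs-agree ¬a x y x≤6 y≤6 | tri> _ _ y<x with agreement′ ¬a y<x x≤6
    ...   | d , eq , ag , refl = trans (ag .descending) (cong down (sym eq))

    injective : ¬ Arc D (P 0) (P 6) → ∀ x y → x ≤ 6 → y ≤ 6 → P x ≡ P y → x ≡ y
    injective ¬a x y x≤6 y≤6 eq with <-cmp x y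
    ... | tri≈ _ x≡y _ = x≡y
    ... | tri< x<y _ _ with agreement′ ¬a x<y y≤6
    ...   | d , _ , ag , refl = ⊥-elim (ag .distinct eq)
    injective ¬a x y x≤6 y≤6 eq | tri> _ _ y<x with agreement′ ¬a y<x x≤6
    ...   | d , _ , ag , refl = ⊥-elim (ag .distinct (sym eq))

    -- Multiplication by 2 carries C₇(1, 2) to C₇(2, 4).
    double : Fin 7 → Fin 7
    double u = (toℕ u + toℕ u) mod 7

    double-inj : ∀ u v → double u ≡ double v → u ≡ v
    double-inj = toWitness {a? = Finₚ.all? λ u → Finₚ.all? λ v → (double u Finₚ.≟ double v) →-dec (u Finₚ.≟ v)} tt

    double-arc : ∀ u v → C₇-arc (toℕ (double u)) (toℕ (double v)) ≡ arc C7-12 u v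
    double-arc = toWitness {a? = Finₚ.all? λ u → Finₚ.all? λ v →
      C₇-arc (toℕ (double u)) (toℕ (double v)) Boolₚ.≟ arc C7-12 u v} tt

    at-most-6 : ∀ (u : Fin 7) → toℕ u ≤ 6
    at-most-6 u = ≤-pred (toℕ<n u)

    case : Dec (Arc D (P 0) (P 6)) → Forbidden D
    case (yes a) = triangle⇒Forbidden (a , no-6-0) (backward-asym 3) (backward-asym 0)
    case (no ¬a) = inj₂ (inj₁ record
      { f     = λ u → P (toℕ (double u))
      ; f-inj = λ {u} {v} eq → double-inj u v (toℕ-injective (injective ¬a _ _ (at-most-6 (double u)) (at-most-6 (double v)) eq))
      ; f-arc = λ u v → trans (arcs-agree ¬a _ _ (at-most-6 (double u)) (at-most-6 (double v))) (double-arc u v) })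

-- Differences between positions on the cycle of length 2k - 1 for k = κ + 3, in the shape that the
-- lemmas on spirals expect; most names tell which two places are compared.
private
  top-far : ∀ κ → 8 + κ + κ + κ ≡ (2 + κ) + ((3 + κ) + (3 + κ))
  top-far = solve-∀
  mid-far : ∀ κ → 8 + κ + κ + κ ≡ (3 + κ) + (3 + κ) + (2 + κ)
  mid-far = solve-∀
  high-top : ∀ a t → (3 + (a + t)) + (3 + (a + t)) ≡ (2 + t) + (4 + (a + t) + a)
  high-top = solve-∀
  low-top : ∀ a t → (3 + (a + t)) + (3 + (a + t)) ≡ (3 + (a + t)) + ((3 + t) + a)
  low-top = solve-∀
  mid-high : ∀ κ a → 4 + κ + a ≡ (2 + a) + (2 + κ)
  mid-high = solve-∀
  low-mid : ∀ a t → 2 + (a + t) ≡ (2 + t) + a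
  low-mid = solve-∀
  high-far : ∀ κ → 8 + κ + κ + κ ≡ (4 + κ) + (4 + κ + κ)
  high-far = solve-∀
  high-far′ : ∀ a t → 8 + (a + t) + (a + t) + (a + t) ≡ (3 + (a + t)) + ((1 + t) + (4 + (a + t) + a))
  high-far′ = solve-∀
  low-far : ∀ a t → 8 + (a + t) + (a + t) + (a + t) ≡ (3 + (a + t)) + ((3 + (a + t)) + ((2 + t) + a))
  low-far = solve-∀
  low-high : ∀ κ d b → 4 + κ + (suc d + b) ≡ (3 + κ) + ((2 + d) + b)
  low-high = solve-∀
  high-low-near : ∀ a d s → 4 + ((2 + d + a) + s) + a ≡ (4 + a + s) + (2 + d + a)
  high-low-near = solve-∀
  add-difference : ∀ x d a → x + (d + a) ≡ d + (x + a)
  add-difference = solve-∀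

module LongSpirals (D : Digraph) (in-semi : LocallyInSemicomplete D) (¬forb : ¬ Forbidden D) where
  open Cliques D
  open Windows D in-semi ¬forb
  open Spirals D in-semi ¬forb

  -- For k = κ + 3 the positions 2k, k − 1, 3k − 1, 2k − 2, k − 3, 2k − 3, k − 4, …, k + 1, 0
  -- form an induced cycle of length 2k − 1.
  no-spiral-3+ : ∀ κ {P} → ¬ Spiral (3 + κ) P
  no-spiral-3+ κ {P} spiral = ¬forb (inj₁ (suc κ , DirectedCycle-embedding D m (s≤s (s≤s (s≤s z≤n))) c fwd bwd))
    where
    k = 3 + κ
    open SpiralArcs {k} {P} (s≤s (s≤s z≤n)) spiral
    m = suc (suc (suc (suc κ + suc κ)))

    c : ℕ → V
    c 0 = P (k + k)
    c 1 = P (2 + κ)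
    c 2 = P (8 + κ + κ + κ)
    c (suc (suc (suc i))) = alternate (λ t → P (suc k + (κ ∸ t))) (λ t → P (κ ∸ t)) i

    -- In terms of k = κ + 3, `high a t` is the position 2k - 2 - t and `low a t` the position k - 3
    -- - t.
    data Place : ℕ → Set where
      top  : Place 0
      mid  : Place 1
      far  : Place 2
      high : ∀ a t → a + t ≡ κ → Place (3 + (t + t))
      low  : ∀ a t → a + t ≡ κ → Place (4 + (t + t))

    position : ∀ {i} → Place i → ℕ
    position top          = k + k
    position mid          = 2 + κ
    position far          = 8 + κ + κ + κ
    position (high a t _) = suc k + a
    position (low a t _)  = a

    at : ∀ {i} (p : Place i) → c i ≡ P (position p)
    at top = refl
    at mid = refl
    at far = refl
    at (high a t refl) = trans (alternate-even _ _ t) (cong (λ x → P (suc k + x)) (m+n∸n≡m a t))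
    at (low a t refl) = trans (alternate-odd (λ t → P (suc k + (κ ∸ t))) _ t) (cong P (m+n∸n≡m a t))

    place : ∀ i → i < m → Place i
    place 0 _ = top
    place 1 _ = mid
    place 2 _ = far
    place (suc (suc (suc i))) (s≤s (s≤s (s≤s i<m))) with parityView i
    ... | even t = high (κ ∸ t) t (m∸n+n≡m (double-<⇒≤ {t} {κ} (≤-trans (≤-pred i<m) (≤-reflexive (+-suc κ κ)))))
    ... | odd t  = low (κ ∸ t) t (m∸n+n≡m (double-<⇒≤ {t} {κ} (≤-trans (n≤1+n _) (≤-trans (≤-pred i<m) (≤-reflexive (+-suc κ κ))))))

    -- Stated symmetrically, so that each pair of places needs a direct argument in one order only;
    -- it implies that every arc follows the cycle.
    Related : ℕ → ℕ → V → V → Set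
    Related i j u v = ¬ Adj u v ⊎ (Asym u v × Next m i j) ⊎ (Asym v u × Next m j i)

    swap-related : ∀ {i j u v} → Related i j u v → Related j i v u
    swap-related (inj₁ ¬adj) = inj₁ (¬adj ∘ Adj-sym)
    swap-related (inj₂ (inj₁ r)) = inj₂ (inj₂ r)
    swap-related (inj₂ (inj₂ r)) = inj₂ (inj₁ r)

    same : ∀ {i j u v} → u ≡ v → Related i j u v
    same refl = inj₁ [ Arc-irrefl refl , Arc-irrefl refl ]′

    onward : ∀ {i j u v u′ v′} → u ≡ u′ → v ≡ v′ → Asym u′ v′ → Next m i j → Related i j u v
    onward refl refl a next = inj₂ (inj₁ (a , next))

    ≤κ : ∀ {a t} → a + t ≡ κ → a ≤ κ
    ≤κ {a} {t} e = subst (a ≤_) e (m≤m+n a t)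

    -- Positions of the same kind differ by at most κ, which is less than k.
    translate : ∀ x {i j a b} → (a ≡ b → Related i j (P (x + a)) (P (x + b))) → a ≤ κ → b ≤ κ →
      Related i j (P (x + a)) (P (x + b))
    translate x {a = a} {b} diagonal a≤κ b≤κ with <-cmp a b
    ... | tri< a<b _ _ = inj₁ (at-most-k (b ∸ a)
          (trans (cong (x +_) (sym (m∸n+n≡m (<⇒≤ a<b)))) (add-difference x (b ∸ a) a))
          (m<n⇒0<n∸m a<b) (s≤s (≤-trans (m∸n≤m b a) (≤-trans b≤κ (m≤n+m κ 2)))))
    ... | tri≈ _ a≡b _ = diagonal a≡b
    ... | tri> _ _ b<a = inj₁ (at-most-k (a ∸ b)
          (trans (cong (x +_) (sym (m∸n+n≡m (<⇒≤ b<a)))) (add-difference x (a ∸ b) b))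
          (m<n⇒0<n∸m b<a) (s≤s (≤-trans (m∸n≤m a b) (≤-trans a≤κ (m≤n+m κ 2)))) ∘ Adj-sym)

    -- The difference of the positions is k + 1 + a - b. It gives the backward arc for b = a and the
    -- forward arc for b = a + 1, lies strictly between k + 1 and 2k for b < a, and is positive and
    -- below k for b > a + 1.
    high-low : ∀ a t → (e : a + t ≡ κ) → ∀ b s → (e′ : b + s ≡ κ) →
      Related (3 + (t + t)) (4 + (s + s)) (P (suc k + a)) (P b)
    high-low a t e b s e′ with <-cmp a b
    ... | tri≈ _ refl _ with refl ← +-cancelˡ-≡ a t s (trans e (sym e′)) = onward refl refl (backward-asym a) (inj₁ refl)
    high-low a t e b s e′ | tri> _ _ b<a with a ∸ suc b | m+[n∸m]≡n b<a
    ... | d | refl = inj₁ (between-k-and-2k (2 + d)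
            (trans (cong (suc k +_) (cong suc (+-comm b d))) (low-high κ d b)) (s≤s (s≤s z≤n))
            (s≤s (s≤s (≤-trans (≤-trans (s≤s (m≤n+m d b)) (≤κ e)) (n≤1+n κ)))) ∘ Adj-sym)
    high-low a t e b s e′ | tri< a<b _ _ with b ∸ suc a | m+[n∸m]≡n a<b
    ... | zero | refl with refl ← +-cancelˡ-≡ a t (suc s) (trans e (trans (sym e′) (trans (cong (λ x → suc x + s) (+-identityʳ a)) (sym (+-suc a s)))))
        = swap-related (onward refl
            (cong P (trans (sym (+-suc k a)) (cong (λ x → k + suc x) (sym (+-identityʳ a)))))
            (forward (suc (a + 0))) (inj₁ (cong (3 +_) (cong suc (+-suc s s)))))
    ... | suc d | refl = inj₁ (at-most-k (4 + a + s)
            (trans (cong (λ x → 4 + x + a) (trans (sym e′) (cong (_+ s) b≡)))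
              (trans (high-low-near a d s) (cong (4 + a + s +_) (sym b≡))))
            (s≤s z≤n) (s≤s (s≤s (s≤s (≤-trans (≤-trans (s≤s (s≤s (m≤n+m (a + s) d))) (≤-reflexive (trans (sym (+-assoc (2 + d) a s)) (cong (_+ s) (sym b≡))))) (≤-reflexive e′))))) ∘ Adj-sym)
      where
      b≡ : suc (a + suc d) ≡ 2 + d + a
      b≡ = trans (cong suc (+-comm a (suc d))) refl

    top-related : ∀ {j} (q : Place j) → Related 0 j (P (k + k)) (P (position q))
    top-related top = same refl
    top-related mid = onward (cong P (+-suc k (2 + κ))) refl (backward-asym (2 + κ)) (inj₁ refl)
    top-related far = inj₁ (at-most-k (2 + κ) (top-far κ) (s≤s z≤n) ≤-refl)
    top-related (high a t refl) = inj₁ (at-most-k (2 + t) (high-top a t) (s≤s z≤n) (s≤s (s≤s (s≤s (m≤n+m t a)))) ∘ Adj-sym)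
    -- The chord from position 0 to 2k closes the cycle; the other low positions are strictly
    -- between k + 1 and 2k away from 2k.
    top-related (low zero t refl) = swap-related (onward refl (cong P (sym (+-identityʳ (k + k)))) (chord-asym 0)
      (inj₂ (cong (4 +_) (sym (+-suc t t)) , refl)))
    top-related (low (suc a) t refl) = inj₁ (between-k-and-2k (3 + t) (low-top (suc a) t) (s≤s (s≤s z≤n))
      (s≤s (s≤s (s≤s (s≤s (m≤n+m t a))))) ∘ Adj-sym)

    mid-related : ∀ {j} (q : Place j) → Related 1 j (P (2 + κ)) (P (position q))
    mid-related mid = same refl
    mid-related far = onward refl (cong P (mid-far κ)) (chord-asym (2 + κ)) (inj₁ refl)
    mid-related (high a t e) = inj₁ (at-most-k (2 + a) (mid-high κ a) (s≤s z≤n) (s≤s (s≤s (s≤s (≤κ e)))))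
    mid-related (low a t refl) = inj₁ (at-most-k (2 + t) (low-mid a t) (s≤s z≤n) (s≤s (s≤s (s≤s (m≤n+m t a)))) ∘ Adj-sym)
    mid-related top = swap-related (top-related mid)

    far-related : ∀ {j} (q : Place j) → Related 2 j (P (8 + κ + κ + κ)) (P (position q))
    far-related far = same refl
    far-related (high a zero e) with refl ← trans (sym (+-identityʳ a)) e =
      onward (cong P (high-far κ)) refl (backward-asym (suc k + κ)) (inj₁ refl)
    far-related (high a (suc t) refl) = inj₁ (between-k-and-2k (2 + t) (high-far′ a (suc t)) (s≤s (s≤s z≤n))
      (s≤s (s≤s (s≤s (≤-trans (n≤1+n t) (m≤n+m (suc t) a))))) ∘ Adj-sym)
    -- These are the only pairs at a difference above 2k.
    far-related (low a t refl) = inj₁ (beyond-2k (2 + t) (low-far a t) (s≤s (s≤s z≤n)) (s≤s (s≤s (s≤s (m≤n+m t a)))) ∘ Adj-sym)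
    far-related top = swap-related (top-related far)
    far-related mid = swap-related (mid-related far)

    high-related : ∀ a t → a + t ≡ κ → ∀ {j} (q : Place j) → Related (3 + (t + t)) j (P (suc k + a)) (P (position q))
    high-related a t e (high b s e′) = translate (suc k) (λ eq → same (cong (λ x → P (suc k + x)) eq)) (≤κ e) (≤κ e′)
    high-related a t e (low b s e′) = high-low a t e b s e′
    high-related a t e top = swap-related (top-related (high a t e))
    high-related a t e mid = swap-related (mid-related (high a t e))
    high-related a t e far = swap-related (far-related (high a t e))

    low-related : ∀ a t → a + t ≡ κ → ∀ {j} (q : Place j) → Related (4 + (t + t)) j (P a) (P (position q))
    low-related a t e (low b s e′) = translate 0 (λ eq → same (cong P eq)) (≤κ e) (≤κ e′)
    low-related a t e top = swap-related (top-related (low a t e))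
    low-related a t e mid = swap-related (mid-related (low a t e))
    low-related a t e far = swap-related (far-related (low a t e))
    low-related a t e (high b s e′) = swap-related (high-low b s e′ a t e)

    related : ∀ {i j} (p : Place i) (q : Place j) → Related i j (P (position p)) (P (position q))
    related top          = top-related
    related mid          = mid-related
    related far          = far-related
    related (high a t e) = high-related a t e
    related (low a t e)  = low-related a t e

    step : ∀ {i} (p : Place i) → suc i < m → Arc D (P (position p)) (c (suc i))
    step top _ = subst (λ y → Arc D (P y) (P (2 + κ))) (sym (+-suc k (2 + κ))) (backward (2 + κ))
    step mid _ = subst (λ y → Arc D (P (2 + κ)) (P y)) (sym (mid-far κ)) (chord (2 + κ))
    step far _ = subst (λ y → Arc D (P y) (P (suc k + κ))) (sym (high-far κ)) (backward (suc k + κ))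
    step (high a t e) _ = subst (Arc D (P (suc k + a))) (sym (at (low a t e))) (backward a)
    step (low zero t refl) i<m = ⊥-elim (<-irrefl (cong (4 +_) (sym (+-suc t t))) i<m)
    step (low (suc a) t e) _ = subst (Arc D (P (suc a)))
      (trans (cong P (+-suc k a)) (trans (sym (at (high a (suc t) (trans (+-suc a t) e)))) (cong c (cong (4 +_) (+-suc t t)))))
      (proj₁ (forward (suc a)))

    fwd : ∀ i j → i < m → j < m → Next m i j → Arc D (c i) (c j)
    fwd i _ i<m j<m (inj₁ refl) = subst (λ v → Arc D v (c (suc i))) (sym (at (place i i<m))) (step (place i i<m) j<m)
    fwd i _ i<m j<m (inj₂ (last , refl)) = subst₂ (Arc D) (sym (trans (cong c i≡) (at (low 0 κ refl))))
        (cong P (+-identityʳ (k + k))) (chord 0)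
      where
      i≡ : i ≡ 4 + (κ + κ)
      i≡ = suc-injective (trans last (cong (4 +_) (+-suc κ κ)))

    bwd : ∀ i j → i < m → j < m → Arc D (c i) (c j) → Next m i j
    bwd i j i<m j<m a with related (place i i<m) (place j j<m)
    ... | inj₁ ¬adj = ⊥-elim (¬adj (inj₁ (subst₂ (Arc D) (at (place i i<m)) (at (place j j<m)) a)))
    ... | inj₂ (inj₁ (_ , next)) = next
    ... | inj₂ (inj₂ ((_ , ¬a) , _)) = ⊥-elim (¬a (subst₂ (Arc D) (at (place i i<m)) (at (place j j<m)) a))

-- Moving tokens in a locally in-semicomplete digraph

module Tokens (D : Digraph) (in-semi : LocallyInSemicomplete D) (¬forb : ¬ Forbidden D) where
  open Cliques D
  open Windows D in-semi ¬forb
  open Spirals D in-semi ¬forb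
  open LongSpirals D in-semi ¬forb

  record State : Set where
    field
      S           : V → Bool
      s v         : V
      independent : ∀ x y → S x ≡ true → S y ≡ true → ¬ Arc D x y
      s∈S         : S s ≡ true
      v∉S         : S v ≡ false
      s→v         : Arc D s v
      v↛S         : ∀ t → S t ≡ true → ¬ Arc D v t
      only-s      : ∀ t → S t ≡ true → Arc D t v → t ≡ s
      absorbing   : ∀ x → S x ≡ true ⊎ x ≡ v ⊎ Arc D x v ⊎ ∃ λ t → S t ≡ true × Arc D x t

  abstract
    insert : V → (V → Bool) → V → Bool
    insert v S x with x Finₚ.≟ v
    ... | yes _ = true
    ... | no _  = S x

    delete : V → (V → Bool) → V → Bool
    delete s S x with x Finₚ.≟ s
    ... | yes _ = false
    ... | no _  = S x

    insert-new : ∀ v S → insert v S v ≡ true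
    insert-new v S with v Finₚ.≟ v
    ... | yes _  = refl
    ... | no v≢v = ⊥-elim (v≢v refl)

    insert-old : ∀ v S {x} → S x ≡ true → insert v S x ≡ true
    insert-old v S {x} Sx with x Finₚ.≟ v
    ... | yes _ = refl
    ... | no _  = Sx

    insert-out : ∀ v S {x} → insert v S x ≡ true → x ≡ v ⊎ S x ≡ true
    insert-out v S {x} e with x Finₚ.≟ v
    ... | yes x≡v = inj₁ x≡v
    ... | no _    = inj₂ e

    delete-keep : ∀ s S {x} → S x ≡ true → x ≢ s → delete s S x ≡ true
    delete-keep s S {x} Sx x≢s with x Finₚ.≟ s
    ... | yes x≡s = ⊥-elim (x≢s x≡s)
    ... | no _    = Sx

    delete-out : ∀ s S {x} → delete s S x ≡ true → S x ≡ true × x ≢ s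
    delete-out s S {x} e with x Finₚ.≟ s
    ... | no x≢s = e , x≢s

  -- `out`, `keep` and `new` express that σ.s is replaced by σ.v; `v→s` says that the next
  -- unabsorbed vertex is an in-neighbour of the position just left.
  record Step (σ τ : State) : Set where
    private
      module σ = State σ
      module τ = State τ
    field
      v→s  : Arc D τ.v σ.s
      out  : ∀ {x} → τ.S x ≡ true → x ≡ σ.v ⊎ (σ.S x ≡ true × x ≢ σ.s)
      keep : ∀ {x} → σ.S x ≡ true → x ≢ σ.s → τ.S x ≡ true
      new  : τ.S σ.v ≡ true

  Independent : (V → Bool) → Set
  Independent S = ∀ x y → S x ≡ true → S y ≡ true → ¬ Arc D x y

  Unabsorbed : (V → Bool) → V → Set
  Unabsorbed S x = S x ≡ false × (∀ t → S t ≡ true → ¬ Arc D x t)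

  Unabsorbed? : ∀ S x → Dec (Unabsorbed S x)
  Unabsorbed? S x = (S x Boolₚ.≟ false) ×-dec Finₚ.all? λ t → (S t Boolₚ.≟ true) →-dec ¬? (Arc? x t)

  absorbed : ∀ S {x} → ¬ Unabsorbed S x → S x ≡ true ⊎ ∃ λ t → S t ≡ true × Arc D x t
  absorbed S {x} ¬un with S x
  ... | true  = inj₁ refl
  ... | false with Finₚ.any? (λ t → (S t Boolₚ.≟ true) ×-dec Arc? x t)
  ...   | yes found = inj₂ found
  ...   | no none   = ⊥-elim (¬un (refl , λ t St a → none (t , St , a)))

  insert-independent : ∀ v S → Independent S → (∀ t → S t ≡ true → ¬ Arc D v t) → (∀ t → S t ≡ true → ¬ Arc D t v) →
    Independent (insert v S)
  insert-independent v S ind v↛ ↛v x y Sx Sy a with insert-out v S Sx | insert-out v S Sy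
  ... | inj₁ refl | inj₁ refl = Arc-irrefl refl a
  ... | inj₁ refl | inj₂ Sy′  = v↛ y Sy′ a
  ... | inj₂ Sx′  | inj₁ refl = ↛v x Sx′ a
  ... | inj₂ Sx′  | inj₂ Sy′  = ind x y Sx′ Sy′ a

  -- Put S′ = S - s + v. It is independent, and any vertex it leaves unabsorbed was absorbed by s
  -- alone. As S′ is no kernel, such vertices exist; inside the in-neighbourhood of s they have a
  -- sink w. Some member of S′ has an arc to w, since otherwise S′ + w would be a kernel.
  step : ¬ HasKernel D → (σ : State) → Σ State (Step σ)
  step ¬kernel σ = τ , record
    { v→s  = un→s (proj₁ (proj₂ sink))
    ; out  = λ e → [ inj₁ , inj₂ ∘ delete-out s S ]′ (insert-out v _ e)
    ; keep = λ Sx x≢s → insert-old v _ (delete-keep s S Sx x≢s)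
    ; new  = insert-new v _ }
    where
    open State σ
    S′ = insert v (delete s S)

    S′-independent : Independent S′
    S′-independent = insert-independent v (delete s S)
      (λ x y Sx Sy → independent x y (proj₁ (delete-out s S Sx)) (proj₁ (delete-out s S Sy)))
      (λ t St → v↛S t (proj₁ (delete-out s S St)))
      (λ t St t→v → proj₂ (delete-out s S St) (only-s t (proj₁ (delete-out s S St)) t→v))

    un→s : ∀ {x} → Unabsorbed S′ x → Arc D x s
    un→s {x} (S′x , x↛) with absorbing x
    ... | inj₁ Sx with x Finₚ.≟ s
    -- The vacated vertex s is absorbed by its arc to v.
    ...   | yes refl = ⊥-elim (x↛ v (insert-new v _) s→v)
    ...   | no x≢s   = ⊥-elim (true≢false (insert-old v _ (delete-keep s S Sx x≢s)) S′x)
    un→s (S′x , x↛) | inj₂ (inj₁ refl) = ⊥-elim (true≢false (insert-new v _) S′x)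
    un→s (S′x , x↛) | inj₂ (inj₂ (inj₁ x→v)) = ⊥-elim (x↛ v (insert-new v _) x→v)
    un→s (S′x , x↛) | inj₂ (inj₂ (inj₂ (t , St , x→t))) with t Finₚ.≟ s
    ... | yes refl = x→t
    ... | no t≢s   = ⊥-elim (x↛ t (insert-old v _ (delete-keep s S St t≢s)) x→t)

    some-unabsorbed : ∃ (Unabsorbed S′)
    some-unabsorbed with Finₚ.any? (Unabsorbed? S′)
    ... | yes found = found
    ... | no none   = ⊥-elim (¬kernel (S′ , S′-independent , λ u S′u →
            [ (λ S′u′ → ⊥-elim (true≢false S′u′ S′u)) , id ]′ (absorbed S′ (λ un → none (u , un)))))

    sink = semicomplete-sink ¬forb (Unabsorbed? S′)
      (λ x y un-x un-y → in-semi s x y (un→s un-x) (un→s un-y)) some-unabsorbed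
    w = proj₁ sink

    predecessor : ∃ λ t → S′ t ≡ true × Arc D t w
    predecessor with Finₚ.any? (λ t → (S′ t Boolₚ.≟ true) ×-dec Arc? t w)
    ... | yes found = found
    ... | no none   = ⊥-elim (¬kernel (insert w S′ ,
            insert-independent w S′ S′-independent (proj₂ (proj₁ (proj₂ sink))) (λ t St a → none (t , St , a)) ,
            absorbs))
      where
      absorbs : ∀ u → insert w S′ u ≡ false → ∃ λ t → insert w S′ t ≡ true × Arc D u t
      absorbs u ∉ with Unabsorbed? S′ u
      ... | yes un = w , insert-new w S′ , proj₂ (proj₂ sink) u un λ { refl → true≢false (insert-new w S′) ∉ }
      ... | no ¬un with absorbed S′ ¬un
      ...   | inj₁ S′u = ⊥-elim (true≢false (insert-old w S′ S′u) ∉)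
      ...   | inj₂ (t , S′t , u→t) = t , insert-old w S′ S′t , u→t

    τ : State
    τ = record
      { S = S′ ; s = proj₁ predecessor ; v = w
      ; independent = S′-independent
      ; s∈S = proj₁ (proj₂ predecessor)
      ; v∉S = proj₁ (proj₁ (proj₂ sink))
      ; s→v = proj₂ (proj₂ predecessor)
      ; v↛S = proj₂ (proj₁ (proj₂ sink))
      -- Two members of S′ with arcs to w would be adjacent, against independence.
      ; only-s = λ t S′t t→w → decidable-stable (t Finₚ.≟ proj₁ predecessor) λ t≢ →
          [ S′-independent _ _ S′t (proj₁ (proj₂ predecessor)) , S′-independent _ _ (proj₁ (proj₂ predecessor)) S′t ]′
            (in-semi w _ _ t→w (proj₂ (proj₂ predecessor)) t≢)
      ; absorbing = absorbs }
      where
      absorbs : ∀ x → S′ x ≡ true ⊎ x ≡ w ⊎ Arc D x w ⊎ ∃ λ t → S′ t ≡ true × Arc D x t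
      absorbs x with Unabsorbed? S′ x
      ... | no ¬un = [ inj₁ , inj₂ ∘ inj₂ ∘ inj₂ ]′ (absorbed S′ ¬un)
      ... | yes un with x Finₚ.≟ w
      ...   | yes x≡w = inj₂ (inj₁ x≡w)
      ...   | no x≢w  = inj₂ (inj₂ (inj₁ (proj₂ (proj₂ sink) x un x≢w)))

  module Run (states : ℕ → State) (steps : ∀ i → Step (states i) (states (suc i))) where
    private
      module State′ (i : ℕ) = State (states i)
      module Step′ (i : ℕ) = Step (steps i)
    open State′
    open Step′

    infix 4 _∈S_
    _∈S_ : V → ℕ → Set
    x ∈S i = S i x ≡ true

    v∉ : ∀ {i x} → x ∈S i → x ≢ v i
    v∉ {i} x∈ refl = true≢false x∈ (v∉S i)

    s-leaves : ∀ {i x} → x ∈S suc i → x ≢ s i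
    s-leaves {i} x∈ refl with out i x∈
    ... | inj₁ s≡v     = v∉ (s∈S i) s≡v
    ... | inj₂ (_ , s≢s) = s≢s refl

    apart : ∀ {i x y} → x ∈S i → y ∈S i → x ≢ y → Apart x y
    apart {i} x∈ y∈ x≢y = x≢y , [ independent i _ _ x∈ y∈ , independent i _ _ y∈ x∈ ]′

    asym : ∀ i → Asym (s i) (v i)
    asym i = s→v i , v↛S i (s i) (s∈S i)

    -- The token that moves at time b already stands at `s b` at time a and rests there in between.
    Alive : ℕ → ℕ → Set
    Alive a b = ∀ c → a ≤ c → c ≤ b → s b ∈S c

    alive-self : ∀ b → Alive b b
    alive-self b c b≤c c≤b = subst (s b ∈S_) (≤-antisym b≤c c≤b) (s∈S b)

    alive-back : ∀ {a b} → a < b → Alive (suc a) b → s b ≡ v a ⊎ Alive a b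
    alive-back {a} {b} a<b alive with out a (alive (suc a) ≤-refl a<b)
    ... | inj₁ eq      = inj₁ eq
    ... | inj₂ (∈ , _) = inj₂ extended
      where
      extended : Alive a b
      extended c a≤c c≤b with m≤n⇒m<n∨m≡n a≤c
      ... | inj₁ a<c  = alive c a<c c≤b
      ... | inj₂ refl = ∈

    -- The token that moves at time b made its previous move at time a.
    Born : ℕ → ℕ → Set
    Born a b = a < b × s b ≡ v a × Alive (suc a) b

    birth : ∀ a b → a ≤ b → Alive a b → Alive 0 b ⊎ ∃ λ a′ → Born a′ b
    birth zero b _ alive = inj₁ alive
    birth (suc a) b a<b alive with alive-back a<b alive
    ... | inj₁ eq     = inj₂ (a , a<b , eq , alive)
    ... | inj₂ alive′ = birth a b (<⇒≤ a<b) alive′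

    first-birth : ∀ N → (∀ c → c < N → Alive 0 c) ⊎ ∃₂ λ a b → Born a b × (∀ c → c < b → Alive 0 c)
    first-birth zero = inj₁ λ _ ()
    first-birth (suc N) with first-birth N
    ... | inj₂ found = inj₂ found
    ... | inj₁ all with birth N N ≤-refl (alive-self N)
    ...   | inj₂ (a , born) = inj₂ (a , N , born , all)
    ...   | inj₁ alive      = inj₁ λ c c<1+N → [ all c , (λ { refl → alive }) ]′ (m≤n⇒m<n∨m≡n (≤-pred c<1+N))

    some-birth : ∃₂ λ a b → Born a b × (∀ c → c < b → Alive 0 c)
    some-birth with first-birth (suc (n D))
    ... | inj₂ found = found
    ... | inj₁ all with Finₚ.pigeonhole (n<1+n (n D)) (s ∘ toℕ)
    -- If all moved tokens had rested since time 0, a repetition s i = s j would leave `s j`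
    -- occupied at time i + 1, just after its token has left.
    ...   | i , j , i<j , eq = ⊥-elim (s-leaves (all (toℕ j) (toℕ<n j) (suc (toℕ i)) z≤n i<j) (sym eq))

    -- k tokens move in turn, starting at time a, before the first of them moves again.
    record Rotation (k a : ℕ) : Set where
      field
        present : ∀ l → l < k → Alive a (l + a)
        again   : s (k + a) ≡ v a
        stays   : Alive (suc a) (k + a)

    -- Take the earliest time b of a second move. All tokens moving before b have rested since time
    -- 0, in particular those moving from a to b - 1.
    some-rotation : ∃₂ λ k a → Rotation (suc k) a
    some-rotation with some-birth
    ... | a , b , (a<b , eq , alive) , all = b ∸ suc a , a , record
      { present = λ l l<k c a≤c c≤ → all (l + a) (subst (l + a <_) b≡ (+-monoˡ-< a l<k)) c z≤n c≤
      ; again   = trans (cong s b≡) eq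
      ; stays   = subst (Alive (suc a)) (sym b≡) alive }
      where
      b≡ : suc (b ∸ suc a) + a ≡ b
      b≡ = trans (sym (+-suc (b ∸ suc a) a)) (m∸n+n≡m a<b)

    module Window-of {k a : ℕ} (rotation : Rotation (suc k) a) where
      open Rotation rotation
      private K = suc k

      token-present : ∀ l c → c ≤ l → l < K → s (l + a) ∈S (c + a)
      token-present l c c≤l l<K = present l l<K (c + a) (m≤n+m a c) (+-monoˡ-≤ a c≤l)

      -- Times are counted from a. The token moving at a later time was already in the set at time
      -- y, when `v (y + a)` was not, so it is a different vertex and `v (y + a)` stays. Excluded is
      -- y = 0 with c = K + 1, because that token moves again at time K.
      moved-present : ∀ y c → y < c → c ≤ K ⊎ 1 ≤ y → c ≤ suc K → v (y + a) ∈S (c + a)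
      moved-present y (suc c) y<c late c≤ with m≤n⇒m<n∨m≡n (≤-pred y<c)
      ... | inj₂ refl = new (y + a)
      ... | inj₁ y<c′ = keep (c + a) (moved-present y c y<c′ (inj₁ (≤-pred c≤)) (≤-trans (n≤1+n c) c≤))
              λ eq → v∉ (alive late) (sym eq)
        where
        alive : suc c ≤ K ⊎ 1 ≤ y → s (c + a) ∈S (y + a)
        alive (inj₁ c<K) = token-present c y (<⇒≤ y<c′) c<K
        alive (inj₂ 1≤y) with m≤n⇒m<n∨m≡n (≤-pred c≤)
        ... | inj₁ c<K  = token-present c y (<⇒≤ y<c′) c<K
        -- At time K the first token leaves `v a`, which it has occupied since time 1, hence at time
        -- y.
        ... | inj₂ refl = stays (y + a) (+-monoˡ-≤ a 1≤y) (+-monoˡ-≤ a (<⇒≤ y<c′))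

      -- The K initial positions followed by the vertices moved to; `pos K` is both `v a` and
      -- `s (K + a)`, since the first token moves again.
      pos : ℕ → V
      pos x with x <? K
      ... | yes _ = s (x + a)
      ... | no _  = v (x ∸ K + a)

      pos-s< : ∀ {x} → x < K → pos x ≡ s (x + a)
      pos-s< {x} x<K with x <? K
      ... | yes _  = refl
      ... | no x≮K = ⊥-elim (x≮K x<K)

      pos-v : ∀ y → pos (K + y) ≡ v (y + a)
      pos-v y with K + y <? K
      ... | yes lt = ⊥-elim (<⇒≱ lt (m≤m+n K y))
      ... | no _   = cong (λ z → v (z + a)) (m+n∸m≡n K y)

      pos-s : ∀ {x} → x ≤ K → pos x ≡ s (x + a)
      pos-s x≤K with m≤n⇒m<n∨m≡n x≤K
      ... | inj₁ x<K  = pos-s< x<K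
      ... | inj₂ refl = trans (cong pos (sym (+-identityʳ K))) (trans (pos-v 0) (sym again))

      -- The two positions are occupied at a common time, and independence at that time separates
      -- them; the same holds in the next two lemmas.
      near-ss : ∀ x d → 0 < d → d + x < K → Apart (s (x + a)) (s (d + x + a))
      near-ss x d 0<d lt = apart (s∈S (x + a)) (token-present (d + x) x (m≤n+m x d) lt)
        λ eq → s-leaves (token-present (d + x) (suc x) (+-monoˡ-≤ x 0<d) lt) (sym eq)

      near-sv : ∀ x y → y < x → x < K → Apart (s (x + a)) (v (y + a))
      near-sv x y y<x x<K = apart (s∈S (x + a)) (moved-present y x y<x (inj₁ (<⇒≤ x<K)) (≤-trans (<⇒≤ x<K) (n≤1+n K)))
        (v∉ (token-present x y (<⇒≤ y<x) x<K))

      near-vv : ∀ y d → 0 < d → d < K → d + y ≤ K → Apart (v (y + a)) (v (d + y + a))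
      near-vv y d 0<d d<K le = apart {suc (d + y) + a}
          (moved-present y (suc (d + y)) (s≤s (m≤n+m y d)) (late y d<K le) (s≤s le))
          (new (d + y + a))
          (v∉ (moved-present y (d + y) (+-monoˡ-≤ y 0<d) (inj₁ le) (≤-trans le (n≤1+n K))))
        where
        late : ∀ y → d < K → d + y ≤ K → suc (d + y) ≤ K ⊎ 1 ≤ y
        late zero d<K _    = inj₁ (subst (_< K) (sym (+-identityʳ d)) d<K)
        late (suc y) _ _   = inj₂ (s≤s z≤n)

      window : Window K pos
      window = record { near = near ; forward = forward ; backward = backward }
        where
        near : ∀ x d → 0 < d → d < K → d + x ≤ K + K → Apart (pos x) (pos (d + x))
        near x d 0<d d<K le with x <? K | d + x <? K
        ... | yes _   | yes lt = near-ss x d 0<d lt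
        ... | yes x<K | no nlt with d + x ∸ K | m+[n∸m]≡n (≮⇒≥ nlt)
        ...   | y | eq = near-sv x y (+-cancelˡ-< K y x (subst (_< K + x) (sym eq) (+-monoˡ-< x d<K))) x<K
        near x d 0<d d<K le | no x≮K | no nlt =
          subst (λ z → Apart (v (x ∸ K + a)) (v (z + a))) (sym (+-∸-assoc d (≮⇒≥ x≮K)))
            (near-vv (x ∸ K) d 0<d d<K (+-cancelʳ-≤ K _ _ (subst (_≤ K + K) eq le)))
          where
          eq : d + x ≡ d + (x ∸ K) + K
          eq = trans (cong (d +_) (sym (m∸n+n≡m (≮⇒≥ x≮K)))) (sym (+-assoc d (x ∸ K) K))
        near x d 0<d d<K le | no x≮K | yes lt = ⊥-elim (x≮K (≤-<-trans (m≤n+m x d) lt))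

        forward : ∀ x → x ≤ K → Asym (pos x) (pos (K + x))
        forward x x≤K = subst₂ Asym (sym (pos-s x≤K)) (sym (pos-v x)) (asym (x + a))

        backward : ∀ x → x < K → Arc D (pos (suc K + x)) (pos x)
        backward x x<K = subst₂ (Arc D) (sym (trans (cong pos (sym (+-suc K x))) (pos-v (suc x)))) (sym (pos-s< x<K)) (v→s (x + a))

      two-step-chord : Arc D (s a) (v (K + a))
      two-step-chord = subst₂ (Arc D) (pos-s< {0} (s≤s z≤n)) (pos-v K) (window-chord window)

      origin : ∀ c {t} → t ∈S (c + a) → t ∈S a ⊎ ∃ λ y → y < c × t ≡ v (y + a)
      origin zero t∈ = inj₁ t∈
      origin (suc c) t∈ with out (c + a) t∈
      ... | inj₁ eq = inj₂ (c , ≤-refl , eq)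
      ... | inj₂ (t∈′ , _) with origin c t∈′
      ...   | inj₁ old = inj₁ old
      ...   | inj₂ (y , y<c , eq) = inj₂ (y , <-trans y<c (n<1+n c) , eq)

      -- An arc to `s a` would share its head with v (1 + a) → s a, an arc from `s a` would share
      -- its head with s (y + a) → v (y + a). In both cases the tails are apart.
      far-from-s : ∀ y → 2 ≤ y → y < K → ¬ Adj (v (y + a)) (s a)
      far-from-s (suc y) 2≤y y<K (inj₁ v→s₀) = apart-in
        (apart-sym (near-vv 1 y (≤-pred 2≤y) (<⇒≤ y<K) (subst (_≤ K) (+-comm 1 y) (<⇒≤ y<K))))
        (v→s a) (subst (λ z → Arc D (v (z + a)) (s a)) (+-comm 1 y) v→s₀)
      far-from-s y 2≤y y<K (inj₂ s₀→v) =
        apart-in (subst (λ z → Apart (s a) (s (z + a))) (+-identityʳ y)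
            (near-ss 0 y (≤-trans (s≤s z≤n) 2≤y) (subst (_< K) (sym (+-identityʳ y)) y<K))) (s→v (y + a)) s₀→v

      -- Let w be `v (suc K + a)`. Both w and `s a` have arcs to `v a`, so they are adjacent. If w →
      -- s a, then w and `v (suc a)` share that head, and as w has no arc into the set, `v (suc a)`
      -- is the token. If s a → w, the token is adjacent to `s a`, which excludes the old positions
      -- and, by `far-from-s`, the new ones from the third to the last but one.
      next-token : s (suc K + a) ≡ v (suc a) ⊎ s (suc K + a) ≡ v (K + a)
      next-token with v (suc K + a) Finₚ.≟ s a
      -- The chord from `s a` to `v (K + a)` would absorb w.
      ... | yes eq = ⊥-elim (v↛S (suc K + a) _ (new (K + a)) (subst (λ x → Arc D x (v (K + a))) (sym eq) two-step-chord))
      ... | no w≢s with in-semi (v a) (v (suc K + a)) (s a) (subst (Arc D (v (suc K + a))) again (v→s (K + a))) (s→v a) w≢s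
      ...   | inj₁ w→s with in-semi (s a) (v (suc K + a)) (v (suc a)) w→s (v→s a) (v∉ v₁∈ ∘ sym)
        where
        v₁∈ : v (suc a) ∈S (suc K + a)
        v₁∈ = moved-present 1 (suc K) (s≤s (s≤s z≤n)) (inj₂ ≤-refl) ≤-refl
      ...     | inj₁ w→v₁ = ⊥-elim (v↛S (suc K + a) _ (moved-present 1 (suc K) (s≤s (s≤s z≤n)) (inj₂ ≤-refl) ≤-refl) w→v₁)
      ...     | inj₂ v₁→w = inj₁ (sym (only-s (suc K + a) _ (moved-present 1 (suc K) (s≤s (s≤s z≤n)) (inj₂ ≤-refl) ≤-refl) v₁→w))
      next-token | no w≢s | inj₂ s→w with s (suc K + a) Finₚ.≟ s a
      -- If `s a` were occupied again, the chord would be an arc inside the independent set.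
      ... | yes eq = ⊥-elim (independent (suc K + a) _ _ (s∈S (suc K + a)) (new (K + a))
                       (subst (λ x → Arc D x (v (K + a))) (sym eq) two-step-chord))
      ... | no t≢s with in-semi (v (suc K + a)) (s (suc K + a)) (s a) (s→v (suc K + a)) s→w t≢s | origin (suc K) (s∈S (suc K + a))
      ...   | adj | inj₁ old = ⊥-elim ([ independent a _ _ old (s∈S a) , independent a _ _ (s∈S a) old ]′ adj)
      -- `v a` was vacated at time K.
      ...   | adj | inj₂ (zero , _ , eq) = ⊥-elim (s-leaves (s∈S (suc K + a)) (trans eq (sym again)))
      ...   | adj | inj₂ (suc zero , _ , eq) = inj₁ eq
      ...   | adj | inj₂ (suc (suc y) , y<1+K , eq) with m≤n⇒m<n∨m≡n (≤-pred y<1+K)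
      ...     | inj₂ refl = inj₂ eq
      ...     | inj₁ y<K  = ⊥-elim (far-from-s _ (s≤s (s≤s z≤n)) y<K (subst (λ x → Adj x (s a)) eq adj))

      next-rotation : s (suc K + a) ≡ v (suc a) → Rotation K (suc a)
      next-rotation eq = record
        { present = present′
        ; again   = trans (cong s (+-suc K a)) eq
        ; stays   = λ c 2+a≤c c≤ → subst₂ (λ x i → x ∈S i) (sym (trans (cong s (+-suc K a)) eq)) (m∸n+n≡m (≤-trans (m≤n+m a 2) 2+a≤c))
            (moved-present 1 (c ∸ a) (subst (_≤ c ∸ a) (m+n∸n≡m 2 a) (∸-monoˡ-≤ a 2+a≤c)) (inj₂ ≤-refl)
              (subst (c ∸ a ≤_) (m+n∸n≡m (suc K) a) (∸-monoˡ-≤ a (subst (c ≤_) (+-suc K a) c≤)))) }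
        where
        present′ : ∀ l → l < K → Alive (suc a) (l + suc a)
        present′ l l<K with m≤n⇒m<n∨m≡n l<K
        ... | inj₁ 1+l<K = λ c 1+a≤c c≤ → subst (λ i → s i ∈S c) (sym (+-suc l a))
                (present (suc l) 1+l<K c (<⇒≤ 1+a≤c) (subst (c ≤_) (+-suc l a) c≤))
        ... | inj₂ refl  = subst (Alive (suc a)) (sym (+-suc l a)) stays

      next-rotation-1 : s (suc K + a) ≡ v (K + a) → Rotation 1 (K + a)
      next-rotation-1 eq = record
        { present = λ { zero _ → alive-self (K + a) ; (suc _) (s≤s ()) }
        ; again   = eq
        ; stays   = alive-self (suc K + a) }

    open Window-of using (two-step-chord; next-token; next-rotation; next-rotation-1)

    module Single {a : ℕ} (rotation : Rotation 1 a) where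
      -- For one token both outcomes of `next-token` name the same vertex, so this token moves for
      -- ever.
      rotations : ∀ x → Rotation 1 (x + a)
      rotations zero = rotation
      rotations (suc x) with next-token (rotations x)
      ... | inj₁ eq = next-rotation (rotations x) eq
      ... | inj₂ eq = next-rotation-1 (rotations x) eq

      again : ∀ x → s (suc x + a) ≡ v (x + a)
      again x = Rotation.again (rotations x)

      -- The tokens other than the moving one; they form the same set at every time.
      Rest : ℕ → V → Set
      Rest x t = t ∈S (x + a) × t ≢ s (x + a)

      rest-up : ∀ x {t} → Rest x t → Rest (suc x) t
      rest-up x (t∈ , t≢s) = keep (x + a) t∈ t≢s , λ eq → v∉ t∈ (trans eq (again x))

      rest-down : ∀ x {t} → Rest (suc x) t → Rest x t
      rest-down x (t∈ , t≢s) = [ (λ eq → ⊥-elim (t≢s (trans eq (sym (again x))))) , id ]′ (out (x + a) t∈)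

      rest-0 : ∀ x {t} → Rest x t → Rest 0 t
      rest-0 zero r    = r
      rest-0 (suc x) r = rest-0 x (rest-down x r)

      rest-from-0 : ∀ x {t} → Rest 0 t → Rest x t
      rest-from-0 zero r    = r
      rest-from-0 (suc x) r = rest-up x (rest-from-0 x r)

      -- Look at `s (y + a)` at time x. It is neither a resting token nor absorbed by one, as the
      -- resting tokens are in the independent set at time y as well. So it is absorbed by
      -- `s (x + a)`, equals `v (x + a)`, or shares the out-neighbour `v (x + a)` with `s (x + a)`.
      joined : ∀ y x → s (y + a) ≡ s (x + a) ⊎ Adj (s (y + a)) (s (x + a))
      joined y x with s (y + a) Finₚ.≟ s (x + a)
      ... | yes eq = inj₁ eq
      ... | no ≢ with absorbing (x + a) (s (y + a))
      ...   | inj₁ ∈ = ⊥-elim (proj₂ (rest-from-0 y (rest-0 x (∈ , ≢))) refl)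
      ...   | inj₂ (inj₁ eq) = inj₂ (inj₂ (subst (Arc D (s (x + a))) (sym eq) (s→v (x + a))))
      ...   | inj₂ (inj₂ (inj₁ y→v)) = inj₂ (in-semi _ _ _ y→v (s→v (x + a)) ≢)
      ...   | inj₂ (inj₂ (inj₂ (t , t∈ , y→t))) with t Finₚ.≟ s (x + a)
      ...     | yes refl = inj₂ (inj₁ y→t)
      ...     | no t≢s = ⊥-elim (independent (y + a) _ _ (s∈S (y + a)) (proj₁ (rest-from-0 y (rest-0 x (t∈ , t≢s)))) y→t)

      impossible : ⊥
      impossible = ¬forb (clique-sequence⇒Forbidden (λ x → s (x + a))
        (λ x → subst (Asym (s (x + a))) (sym (again x)) (asym (x + a))) joined)

    module Several {k a : ℕ} (rotation : Rotation (2 + k) a) where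
      K = 2 + k

      -- A single token cannot take over by `Single.impossible`, so the K tokens keep moving in
      -- turn.
      rotations : ∀ x → Rotation K (x + a)
      rotations zero = rotation
      rotations (suc x) with next-token (rotations x)
      ... | inj₁ eq = next-rotation (rotations x) eq
      ... | inj₂ eq = ⊥-elim (Single.impossible (next-rotation-1 (rotations x) eq))

      again : ∀ x → s (K + x + a) ≡ v (x + a)
      again x = trans (cong s (+-assoc K x a)) (Rotation.again (rotations x))

      spiral : Spiral K (λ x → s (x + a))
      spiral = record
        { near     = λ x d 0<d d<K → subst (λ i → Apart (s (x + a)) (s i))
            (trans (cong (_+ (x + a)) (+-identityʳ d)) (sym (+-assoc d x a)))
            (Window-of.near-ss (rotations x) 0 d 0<d (subst (_< K) (sym (+-identityʳ d)) d<K))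
        ; forward  = λ x → subst (Asym (s (x + a))) (sym (again x)) (asym (x + a))
        ; backward = λ x → subst (λ u → Arc D u (s (x + a))) (trans (sym (again (suc x))) (cong (λ i → s (i + a)) (+-suc K x))) (v→s (x + a))
        ; chord    = λ x → subst (Arc D (s (x + a)))
            (trans (cong v (sym (+-assoc K x a))) (trans (sym (again (K + x))) (cong (λ i → s (i + a)) (sym (+-assoc K K x)))))
            (two-step-chord (rotations x)) }

    no-run : ⊥
    no-run with some-rotation
    ... | zero , a , rotation = Single.impossible rotation
    ... | suc zero , a , rotation = no-spiral-2 (Several.spiral rotation)
    ... | suc (suc κ) , a , rotation = no-spiral-3+ κ (Several.spiral rotation)

-- Kernels of vertex-deleted subdigraphs and induction on the order

record NearKernel (D : Digraph) (v : Fin (n D)) : Set where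
  field
    S           : Fin (n D) → Bool
    v∉S         : S v ≡ false
    independent : ∀ x y → S x ≡ true → S y ≡ true → ¬ Arc D x y
    absorbing   : ∀ x → x ≢ v → S x ≡ false → ∃ λ t → S t ≡ true × Arc D x t

near-kernel : ∀ {N} (A : Fin (suc N) → Fin (suc N) → Bool) (A-loopless : ∀ v → A v v ≡ false) (v : Fin (suc N)) →
  let D = record { n = suc N ; arc = A ; loopless = A-loopless } in
  HasKernel (induced D N (punchIn v)) → NearKernel D v
near-kernel {N} A A-loopless v (S′ , ind , abs) = record
  { S = S
  ; v∉S = insertAt-lookup S′ v false
  ; independent = λ x y Sx Sy a → independent (view x Sx) (view y Sy) a
  ; absorbing = λ x x≢v Sx → absorbing x (x≢v ∘ sym) Sx }
  where
  S = insertAt S′ v false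

  view : ∀ x → S x ≡ true → ∃ λ i → S′ i ≡ true × punchIn v i ≡ x
  view x Sx with v Finₚ.≟ x
  ... | yes refl = ⊥-elim (true≢false Sx (insertAt-lookup S′ v false))
  ... | no v≢x = punchOut v≢x ,
        trans (sym (insertAt-punchIn S′ v false _)) (trans (cong S (Finₚ.punchIn-punchOut v≢x)) Sx) ,
        Finₚ.punchIn-punchOut v≢x

  independent : ∀ {x y} → (∃ λ i → S′ i ≡ true × punchIn v i ≡ x) → (∃ λ i → S′ i ≡ true × punchIn v i ≡ y) → A x y ≢ true
  independent (i , S′i , refl) (j , S′j , refl) = ind i j S′i S′j

  absorbing : ∀ x → v ≢ x → S x ≡ false → ∃ λ t → S t ≡ true × A x t ≡ true
  absorbing x v≢x Sx with abs (punchOut v≢x)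
    (trans (sym (insertAt-punchIn S′ v false _)) (trans (cong S (Finₚ.punchIn-punchOut v≢x)) Sx))
  ... | j , S′j , a = punchIn v j , trans (insertAt-punchIn S′ v false j) S′j ,
        subst (λ u → A u (punchIn v j) ≡ true) (Finₚ.punchIn-punchOut v≢x) a

-- The minimal counterexample as an induction: `extend` may use a kernel of every D - v, and the
-- vertex it receives guarantees that D is nonempty.
induct-on-vertices : (C : Digraph → Set) →
  (∀ D m (g : Fin m → Fin (n D)) → (∀ {i j} → g i ≡ g j → i ≡ j) → C D → C (induced D m g)) →
  (∀ D → C D → (∀ v → NearKernel D v) → Fin (n D) → HasKernel D) →
  ∀ N D → n D ≡ N → C D → HasKernel D
induct-on-vertices C hereditary extend zero record { n = zero } refl _ = (λ _ → false) , (λ ()) , λ ()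
induct-on-vertices C hereditary extend (suc N) D@record { n = suc N ; arc = A ; loopless = l } refl c =
  extend D c (λ v → near-kernel A l v (induct-on-vertices C hereditary extend N _ refl
    (hereditary D N (punchIn v) (Finₚ.punchIn-injective v _ _) c))) Fin.zero

-- Such an arc would absorb v, the one vertex that S may leave unabsorbed.
near-kernel-avoids : ∀ D {v} → ¬ HasKernel D → (near : NearKernel D v) → ∀ t → NearKernel.S near t ≡ true → ¬ Arc D v t
near-kernel-avoids D {v} ¬kernel near t St v→t = ¬kernel (S , independent , absorbs)
  where
  open NearKernel near
  absorbs : ∀ u → S u ≡ false → ∃ λ t → S t ≡ true × Arc D u t
  absorbs u Su with u Finₚ.≟ v
  ... | yes refl = t , St , v→t
  ... | no u≢v   = absorbing u u≢v Su

-- Without a kernel of D, the kernel of D - v yields an initial state from which `step` can be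
-- repeated for ever, against `no-run`; decidability of kernels removes the double negation.
in-semicomplete-extend : ∀ D → LocallyInSemicomplete D → ¬ Forbidden D → ∀ v → NearKernel D v → HasKernel D
in-semicomplete-extend D in-semi ¬forb v near = decidable-stable (HasKernel? D) λ ¬kernel →
  no-run (iterate-state ¬kernel) (λ i → proj₂ (step ¬kernel (iterate-state ¬kernel i)))
  where
  open Cliques D
  open Tokens D in-semi ¬forb
  open NearKernel near
  open Run using (no-run)

  absorbing-else : ∀ x → x ≢ v → S x ≡ true ⊎ ∃ λ t → S t ≡ true × Arc D x t
  absorbing-else x x≢v with S x in Sx
  ... | true  = inj₁ refl
  ... | false = inj₂ (absorbing x x≢v Sx)

  predecessor : ¬ HasKernel D → ∃ λ t → S t ≡ true × Arc D t v
  predecessor ¬kernel with Finₚ.any? (λ t → (S t Boolₚ.≟ true) ×-dec Arc? t v)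
  ... | yes found = found
  ... | no none   = ⊥-elim (¬kernel (insert v S ,
          insert-independent v S independent (near-kernel-avoids D ¬kernel near) (λ t St a → none (t , St , a)) , absorbs))
    where
    absorbs : ∀ u → insert v S u ≡ false → ∃ λ t → insert v S t ≡ true × Arc D u t
    absorbs u ∉ with absorbing-else u (λ { refl → true≢false (insert-new v S) ∉ })
    ... | inj₁ Su = ⊥-elim (true≢false (insert-old v S Su) ∉)
    ... | inj₂ (t , St , a) = t , insert-old v S St , a

  initial : ¬ HasKernel D → State
  initial ¬kernel = record
    { S = S ; s = proj₁ before ; v = v
    ; independent = independent
    ; s∈S = proj₁ (proj₂ before)
    ; v∉S = v∉S
    ; s→v = proj₂ (proj₂ before)
    ; v↛S = near-kernel-avoids D ¬kernel near
    ; only-s = λ t St t→v → decidable-stable (t Finₚ.≟ proj₁ before) λ t≢ →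
        [ independent _ _ St (proj₁ (proj₂ before)) , independent _ _ (proj₁ (proj₂ before)) St ]′
          (in-semi v _ _ t→v (proj₂ (proj₂ before)) t≢)
    ; absorbing = absorbs }
    where
    before = predecessor ¬kernel
    absorbs : ∀ x → S x ≡ true ⊎ x ≡ v ⊎ Arc D x v ⊎ ∃ λ t → S t ≡ true × Arc D x t
    absorbs x with x Finₚ.≟ v
    ... | yes x≡v = inj₂ (inj₁ x≡v)
    ... | no x≢v  = [ inj₁ , inj₂ ∘ inj₂ ∘ inj₂ ]′ (absorbing-else x x≢v)

  iterate-state : ¬ HasKernel D → ℕ → State
  iterate-state ¬kernel zero    = initial ¬kernel
  iterate-state ¬kernel (suc i) = proj₁ (step ¬kernel (iterate-state ¬kernel i))

-- Locally out-semicomplete digraphs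

injective⇒surjective : ∀ {m} (f : Fin m → Fin m) → (∀ {x y} → f x ≡ f y → x ≡ y) → ∀ t → ∃ λ x → f x ≡ t
injective⇒surjective {suc m} f f-inj t with Finₚ.any? (λ x → f x Finₚ.≟ t)
... | yes found = found
... | no none = ⊥-elim (<-irrefl refl (Finₚ.injective⇒≤ {f = λ x → punchOut (t≢f x)}
        (λ {x} {y} eq → f-inj (Finₚ.punchOut-injective (t≢f x) (t≢f y) eq))))
  where
  t≢f : ∀ x → t ≢ f x
  t≢f x eq = none (x , sym eq)

module Reduction {m : ℕ} (A : Fin (suc (suc m)) → Fin (suc (suc m)) → Bool) (A-loopless : ∀ v → A v v ≡ false) where
  D : Digraph
  D = record { n = suc (suc m) ; arc = A ; loopless = A-loopless }

  open Cliques D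

  abstract
    closed : V → V → Bool
    closed v x = does (v Finₚ.≟ x) ∨ A v x

    closed-in : ∀ {v x} → v ≡ x ⊎ Arc D v x → closed v x ≡ true
    closed-in {v} {x} (inj₁ v≡x) with v Finₚ.≟ x
    ... | yes _  = refl
    ... | no v≢x = ⊥-elim (v≢x v≡x)
    closed-in {v} {x} (inj₂ a) = ∨-true {does (v Finₚ.≟ x)} (inj₂ a)

    closed-out : ∀ {v x} → closed v x ≡ true → v ≡ x ⊎ Arc D v x
    closed-out {v} {x} e with v Finₚ.≟ x
    ... | yes v≡x = inj₁ v≡x
    ... | no _    = inj₂ e

  closed-clique : LocallyOutSemicomplete D → ∀ v → SemicompleteOn D (λ x → closed v x ≡ true)
  closed-clique out-semi v x y cx cy x≢y with closed-out cx | closed-out cy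
  ... | inj₁ refl | inj₁ refl = ⊥-elim (x≢y refl)
  ... | inj₁ refl | inj₂ a    = inj₁ a
  ... | inj₂ a    | inj₁ refl = inj₂ a
  ... | inj₂ a    | inj₂ b    = out-semi v x y a b x≢y

  module _ (out-semi : LocallyOutSemicomplete D) (¬kernel : ¬ HasKernel D) (near : ∀ v → NearKernel D v) where
    private
      module Near (v : V) = NearKernel (near v)
    open Near

    misses : ∀ v i → closed v i ≡ true → S v i ≡ true → ⊥
    misses v i ci Si with closed-out ci
    ... | inj₁ refl = true≢false Si (v∉S v)
    ... | inj₂ a    = near-kernel-avoids D ¬kernel (near v) i Si a

    member : ∀ v u → v ≢ u → ∃ λ p → closed v p ≡ true × S u p ≡ true
    member v u v≢u = go (S u v) refl
      where
      go : ∀ b → S u v ≡ b → ∃ λ p → closed v p ≡ true × S u p ≡ true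
      go true Suv  = v , closed-in (inj₁ refl) , Suv
      go false Suv = let (t , St , a) = absorbing u v v≢u Suv in t , closed-in (inj₂ a) , St

    -- S_u contains or absorbs v, which gives a common vertex; two of them would be adjacent in the
    -- semicomplete N⁺[v], against the independence of S_u.
    hits : ∀ v u → v ≢ u → ∃ λ p → closed v p ≡ true × S u p ≡ true × (∀ i → closed v i ≡ true → S u i ≡ true → i ≡ p)
    hits v u v≢u = let (p , cp , Sp) = member v u v≢u in
      p , cp , Sp , λ i ci Si → decidable-stable (i Finₚ.≟ p) λ i≢p →
        [ independent u i p Si Sp , independent u p i Sp Si ]′ (closed-clique out-semi v i p ci cp i≢p)

    -- Row and column sums agree, so the closed out-neighbourhood of v is the closed in-neighbourhood of its sink;
    -- v ↦ sink v is injective, hence every closed in-neighbourhood arises in this way and is semicomplete.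
    module Sinks (sink : V → V) (out⊆in : ∀ v x → closed v x ≡ true → closed x (sink v) ≡ true) where
      abstract
        in⊆out : ∀ v x → closed x (sink v) ≡ true → closed v x ≡ true
        in⊆out v = LinearAlgebra.Complementary.row⊆column⇒column⊆row closed S hits misses v (sink v) (out⊆in v)

      -- Equal sinks give N⁺[x] = N⁺[y]; but S_x meets N⁺[y] for x ≠ y and misses N⁺[x].
      sink-injective : ∀ {x y} → sink x ≡ sink y → x ≡ y
      sink-injective {x} {y} eq = decidable-stable (x Finₚ.≟ y) λ x≢y →
        let (p , cp , Sp) = member y x (x≢y ∘ sym) in
        misses x p (in⊆out x p (subst (λ t → closed p t ≡ true) (sym eq) (out⊆in y p cp))) Sp

      in-semicomplete : LocallyInSemicomplete D
      in-semicomplete w u v u→w v→w = from (injective⇒surjective sink sink-injective w)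
        where
        from : (∃ λ x → sink x ≡ w) → u ≢ v → Adj u v
        from (x , sink≡w) = closed-clique out-semi x u v (back u→w) (back v→w)
          where
          back : ∀ {y} → Arc D y w → closed x y ≡ true
          back {y} y→w = in⊆out x y (subst (λ t → closed y t ≡ true) (sym sink≡w) (closed-in (inj₂ y→w)))

  out-semicomplete⇒in-semicomplete : LocallyOutSemicomplete D → ¬ Forbidden D → ¬ HasKernel D → (∀ v → NearKernel D v) →
    LocallyInSemicomplete D
  out-semicomplete⇒in-semicomplete out-semi ¬forb ¬kernel near =
    Sinks.in-semicomplete out-semi ¬kernel near (λ v → proj₁ (sink-of v)) out⊆in
    where
    sink-of : ∀ v → Σ V λ t → closed v t ≡ true × (∀ x → closed v x ≡ true → x ≢ t → Arc D x t)
    sink-of v = semicomplete-sink ¬forb (λ x → closed v x Boolₚ.≟ true) (closed-clique out-semi v) (v , closed-in (inj₁ refl))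

    out⊆in : ∀ v x → closed v x ≡ true → closed x (proj₁ (sink-of v)) ≡ true
    out⊆in v x cx = from (x Finₚ.≟ proj₁ (sink-of v))
      where
      from : Dec (x ≡ proj₁ (sink-of v)) → closed x (proj₁ (sink-of v)) ≡ true
      from (yes x≡t) = closed-in (inj₁ x≡t)
      from (no x≢t)  = closed-in (inj₂ (proj₂ (proj₂ (sink-of v)) x cx x≢t))

out-semicomplete-extend : ∀ D → LocallyOutSemicomplete D → ¬ Forbidden D → (∀ v → NearKernel D v) → Fin (n D) → HasKernel D
-- Order 1 is treated apart, since J - I is then zero; a single vertex is trivially locally
-- in-semicomplete.
out-semicomplete-extend D@record { n = suc zero } out-semi ¬forb near v =
  in-semicomplete-extend D (λ { _ Fin.zero Fin.zero _ _ u≢v → ⊥-elim (u≢v refl) }) ¬forb v (near v)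
out-semicomplete-extend D@record { n = suc (suc m) ; arc = A ; loopless = l } out-semi ¬forb near v =
  decidable-stable (HasKernel? D) λ ¬kernel → ¬kernel
    (in-semicomplete-extend D (Reduction.out-semicomplete⇒in-semicomplete A l out-semi ¬forb ¬kernel near) ¬forb v (near v))

-- Sufficiency and the equivalence

in-semicomplete-kernel : ∀ D → LocallyInSemicomplete D → ¬ Forbidden D → HasKernel D
in-semicomplete-kernel D in-semi ¬forb = induct-on-vertices (λ D → LocallyInSemicomplete D × ¬ Forbidden D)
  (λ D m g g-inj (in-semi , ¬forb) → induced-in D m g g-inj in-semi , ¬forb ∘ induced-Forbidden D m g g-inj)
  (λ D (in-semi , ¬forb) near v → in-semicomplete-extend D in-semi ¬forb v (near v))
  (n D) D refl (in-semi , ¬forb)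

out-semicomplete-kernel : ∀ D → LocallyOutSemicomplete D → ¬ Forbidden D → HasKernel D
out-semicomplete-kernel D out-semi ¬forb = induct-on-vertices (λ D → LocallyOutSemicomplete D × ¬ Forbidden D)
  (λ D m g g-inj (out-semi , ¬forb) → induced-out D m g g-inj out-semi , ¬forb ∘ induced-Forbidden D m g g-inj)
  (λ D (out-semi , ¬forb) near v → out-semicomplete-extend D out-semi ¬forb near v)
  (n D) D refl (out-semi , ¬forb)

theorem8 : (D : Digraph) →
    (LocallyInSemicomplete D ⊎ LocallyOutSemicomplete D ⊎ LocallySemicomplete D) →
    (KP D ⇔ (¬ Forbidden D))
theorem8 D local = mk⇔ (KP⇒¬Forbidden D) (kernels local)
  where
  kernels : LocallyInSemicomplete D ⊎ LocallyOutSemicomplete D ⊎ LocallySemicomplete D → ¬ Forbidden D → KP D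
  kernels (inj₁ in-semi) ¬forb = in-semicomplete-kernel D in-semi ¬forb ,
    λ m g g-inj → in-semicomplete-kernel _ (induced-in D m g g-inj in-semi) (¬forb ∘ induced-Forbidden D m g g-inj)
  kernels (inj₂ (inj₁ out-semi)) ¬forb = out-semicomplete-kernel D out-semi ¬forb ,
    λ m g g-inj → out-semicomplete-kernel _ (induced-out D m g g-inj out-semi) (¬forb ∘ induced-Forbidden D m g g-inj)
  kernels (inj₂ (inj₂ (in-semi , _))) = kernels (inj₁ in-semi)
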